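{- For any error $0\le\varepsilon<1$ there is a constant $C_\varepsilon>0$, depending only on $\varepsilon$, such that for every $m\ge1$, every finite set $\mathcal{Z}$ and every total function $f:\{0,1\}^m\to\mathcal{Z}$, $$\liminf_{n\to\infty}\frac{R_\varepsilon(f^n)}{n}\;\ge\;C_\varepsilon\sqrt{D(f)}.$$
   Context: A deterministic query algorithm is a decision tree that adaptively queries single bits of the input; a randomized query algorithm is a probability distribution over deterministic ones. For a function $g$ on bit strings, $D(g)$ is the minimum over deterministic decision trees computing $g$ correctly on every input of the worst-case number of queries, and $R_\varepsilon(g)$ is the minimum, over randomized query algorithms that output $g(y)$ with probability at least $1-\varepsilon$ on every input $y$, of the maximum number of queries over all inputs and all internal randomness. $f^n:(\{0,1\}^m)^n\to\mathcal{Z}^n$ is $f^n(x_1,\dots,x_n)=(f(x_1),\dots,f(x_n))$; an algorithm for $f^n$ is correct only if all $n$ output coordinates are correct. -}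

module Defs where

open import Data.Bool.Base using (Bool)
open import Data.Fin.Base using (Fin)
open import Data.Fin.Properties using (inj⇒≟)
open import Data.Integer.Base as ℤ using (+_)
import Data.Integer.Properties as ℤ
open import Data.Integer.Tactic.RingSolver using (solve-∀)
open import Data.List.Base using (List; foldr; map; filter)
open import Data.List.Relation.Unary.All using (All)
open import Data.Nat.Base as ℕ using (ℕ; zero; suc)
import Data.Nat.Properties as ℕ
open import Data.Product.Base using (∃; _×_; _,_; proj₁; proj₂)
open import Data.Rational.Base as ℚ using (ℚ; mkℚ; 0ℚ; 1ℚ; ½)
import Data.Rational.Properties as ℚ
open import Data.Rational.Solver using (module +-*-Solver)
import Data.Rational.Unnormalised.Base as ℚᵘ
import Data.Rational.Unnormalised.Properties as ℚᵘ
open import Data.Sum.Base using (inj₁; inj₂)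
open import Data.Vec.Base as Vec using (Vec; lookup)
import Data.Vec.Properties as Vec
open import Function.Bundles using (_↔_)
open import Function.Properties.Inverse using (↔⇒↣)
open import Relation.Binary.Definitions using (DecidableEquality)
open import Relation.Binary.PropositionalEquality
  using (_≡_; refl; sym; trans; cong; subst; subst₂)
open import Relation.Nullary.Decidable using (yes; no)

Eventually : (ℕ → Set) → Set
Eventually P = ∃ λ N → ∀ n → N ℕ.≤ n → P n

IsCauchy : (ℕ → ℚ) → Set
IsCauchy x = ∀ δ → 0ℚ ℚ.< δ →
  ∃ λ N → ∀ m n → N ℕ.≤ m → N ℕ.≤ n → ℚ.∣ x m ℚ.- x n ∣ ℚ.< δ

record ℝ : Set where
  constructor mkℝ
  field
    approx : ℕ → ℚ
    cauchy : IsCauchy approx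

open ℝ public

infix 4 _≈ᴿ_ _≤ᴿ_ _<ᴿ_

_≈ᴿ_ _≤ᴿ_ _<ᴿ_ : ℝ → ℝ → Set
x ≈ᴿ y = ∀ δ → 0ℚ ℚ.< δ → Eventually λ n → ℚ.∣ approx x n ℚ.- approx y n ∣ ℚ.< δ
x ≤ᴿ y = ∀ δ → 0ℚ ℚ.< δ → Eventually λ n → approx x n ℚ.≤ approx y n ℚ.+ δ
x <ᴿ y = ∃ λ δ → 0ℚ ℚ.< δ × Eventually λ n → approx x n ℚ.+ δ ℚ.≤ approx y n

fromℚ : ℚ → ℝ
fromℚ q = mkℝ (λ _ → q) λ δ 0<δ → 0 , λ _ _ _ _ →
  subst (ℚ._< δ) (cong ℚ.∣_∣ (sym (ℚ.+-inverseʳ q))) 0<δ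

0ᴿ 1ᴿ : ℝ
0ᴿ = fromℚ 0ℚ
1ᴿ = fromℚ 1ℚ

private
  half>0 : ∀ {δ} → 0ℚ ℚ.< δ → 0ℚ ℚ.< ½ ℚ.* δ
  half>0 {δ} 0<δ = subst (ℚ._< ½ ℚ.* δ) (ℚ.*-zeroʳ ½) (ℚ.*-monoʳ-<-pos ½ 0<δ)

  half+half : ∀ δ → ½ ℚ.* δ ℚ.+ ½ ℚ.* δ ≡ δ
  half+half δ = trans (sym (ℚ.*-distribʳ-+ δ ½ ½)) (ℚ.*-identityˡ δ)

  ∣+∣<halves : ∀ {δ} p q → ℚ.∣ p ∣ ℚ.< ½ ℚ.* δ → ℚ.∣ q ∣ ℚ.< ½ ℚ.* δ →
               ℚ.∣ p ℚ.+ q ∣ ℚ.< δ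
  ∣+∣<halves {δ} p q p< q< = ℚ.≤-<-trans (ℚ.∣p+q∣≤∣p∣+∣q∣ p q)
    (subst (ℚ.∣ p ∣ ℚ.+ ℚ.∣ q ∣ ℚ.<_) (half+half δ) (ℚ.+-mono-< p< q<))

  bounded : ∀ x → IsCauchy x →
    ∃ λ B → ℚ.Positive B × Eventually λ n → ℚ.∣ x n ∣ ℚ.≤ B
  bounded x cx with cx 1ℚ (ℚ.positive⁻¹ 1ℚ)
  ... | N , close = 1ℚ ℚ.+ ℚ.∣ x N ∣
      , ℚ.positive (ℚ.+-mono-<-≤ (ℚ.positive⁻¹ 1ℚ) (ℚ.0≤∣p∣ (x N)))
      , N , λ n N≤n → ℚ.≤-trans
          (ℚ.≤-reflexive (cong ℚ.∣_∣
            (solve 2 (λ a b → a := (a :- b) :+ b) refl (x n) (x N))))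
          (ℚ.≤-trans (ℚ.∣p+q∣≤∣p∣+∣q∣ (x n ℚ.- x N) (x N))
            (ℚ.+-monoˡ-≤ ℚ.∣ x N ∣ (ℚ.<⇒≤ (close n N N≤n ℕ.≤-refl))))
    where open +-*-Solver

  share : ℚ → ∀ C → .{{ℚ.Positive C}} → ℚ
  share δ C = (½ ℚ.* δ) ℚ.* (ℚ.1/ C) {{ℚ.pos⇒nonZero C}}

  share>0 : ∀ {δ} → 0ℚ ℚ.< δ → ∀ C → .{{_ : ℚ.Positive C}} → 0ℚ ℚ.< share δ C
  share>0 {δ} 0<δ C = ℚ.positive⁻¹ (share δ C)
    {{ℚ.pos*pos⇒pos (½ ℚ.* δ) {{ℚ.positive (half>0 0<δ)}}
      ((ℚ.1/ C) {{ℚ.pos⇒nonZero C}}) {{ℚ.1/pos⇒pos C}}}}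

  share*C : ∀ δ C → .{{_ : ℚ.Positive C}} → share δ C ℚ.* C ≡ ½ ℚ.* δ
  share*C δ C = trans (ℚ.*-assoc (½ ℚ.* δ) ((ℚ.1/ C) {{ℚ.pos⇒nonZero C}}) C)
    (trans (cong ((½ ℚ.* δ) ℚ.*_) (ℚ.*-inverseˡ C {{ℚ.pos⇒nonZero C}}))
      (ℚ.*-identityʳ (½ ℚ.* δ)))

  ∣*∣<half : ∀ δ C → .{{_ : ℚ.Positive C}} → ∀ p q →
             ℚ.∣ p ∣ ℚ.< share δ C → ℚ.∣ q ∣ ℚ.≤ C → ℚ.∣ p ℚ.* q ∣ ℚ.< ½ ℚ.* δ
  ∣*∣<half δ C p q p< q≤ = ℚ.≤-<-trans
    (ℚ.≤-trans (ℚ.≤-reflexive (ℚ.∣p*q∣≡∣p∣*∣q∣ p q))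
      (ℚ.*-monoˡ-≤-nonNeg ℚ.∣ p ∣ {{ℚ.∣-∣-nonNeg p}} q≤))
    (subst (ℚ.∣ p ∣ ℚ.* C ℚ.<_) (share*C δ C) (ℚ.*-monoˡ-<-pos C p<))

  *-difference : ∀ a b c d →
    (a ℚ.- b) ℚ.* c ℚ.+ (c ℚ.- d) ℚ.* b ≡ a ℚ.* c ℚ.- b ℚ.* d
  *-difference = solve 4 (λ a b c d →
    (a :- b) :* c :+ (c :- d) :* b := a :* c :- b :* d) refl
    where open +-*-Solver

  *-cauchy : ∀ x y → IsCauchy x → IsCauchy y → IsCauchy (λ n → x n ℚ.* y n)
  *-cauchy x y cx cy δ 0<δ = step (bounded x cx) (bounded y cy)
    where
    Bounded : (ℕ → ℚ) → Set
    Bounded z = ∃ λ B → ℚ.Positive B × Eventually λ n → ℚ.∣ z n ∣ ℚ.≤ B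

    step : Bounded x → Bounded y → ∃ λ N → ∀ m n → N ℕ.≤ m → N ℕ.≤ n →
           ℚ.∣ x m ℚ.* y m ℚ.- x n ℚ.* y n ∣ ℚ.< δ
    step (A , A>0 , K , x≤A) (B , B>0 , L , y≤B)
      = let instance
              _ = A>0
              _ = B>0
            M , xclose = cx (share δ B) (share>0 0<δ B)
            N , yclose = cy (share δ A) (share>0 0<δ A)
        in (M ℕ.⊔ N) ℕ.⊔ (K ℕ.⊔ L) , λ m n m≥ n≥ →
          let MN≤m = ℕ.m⊔n≤o⇒m≤o (M ℕ.⊔ N) (K ℕ.⊔ L) m≥
              MN≤n = ℕ.m⊔n≤o⇒m≤o (M ℕ.⊔ N) (K ℕ.⊔ L) n≥
              KL≤m = ℕ.m⊔n≤o⇒n≤o (M ℕ.⊔ N) (K ℕ.⊔ L) m≥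
              KL≤n = ℕ.m⊔n≤o⇒n≤o (M ℕ.⊔ N) (K ℕ.⊔ L) n≥
          in subst (λ z → ℚ.∣ z ∣ ℚ.< δ) (*-difference (x m) (x n) (y m) (y n))
            (∣+∣<halves ((x m ℚ.- x n) ℚ.* y m) ((y m ℚ.- y n) ℚ.* x n)
              (∣*∣<half δ B (x m ℚ.- x n) (y m)
                (xclose m n (ℕ.m⊔n≤o⇒m≤o M N MN≤m) (ℕ.m⊔n≤o⇒m≤o M N MN≤n))
                (y≤B m (ℕ.m⊔n≤o⇒n≤o K L KL≤m)))
              (∣*∣<half δ A (y m ℚ.- y n) (x n)
                (yclose m n (ℕ.m⊔n≤o⇒n≤o M N MN≤m) (ℕ.m⊔n≤o⇒n≤o M N MN≤n))
                (x≤A n (ℕ.m⊔n≤o⇒m≤o K L KL≤n))))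

infixl 6 _+ᴿ_ _-ᴿ_
infixl 7 _*ᴿ_

_+ᴿ_ : ℝ → ℝ → ℝ
approx (mkℝ x _ +ᴿ mkℝ y _) n = x n ℚ.+ y n
cauchy (mkℝ x cx +ᴿ mkℝ y cy) δ 0<δ
  with cx (½ ℚ.* δ) (half>0 0<δ) | cy (½ ℚ.* δ) (half>0 0<δ)
... | M , xclose | N , yclose = M ℕ.⊔ N , λ m n m≥ n≥ →
  subst (λ z → ℚ.∣ z ∣ ℚ.< δ)
    (solve 4 (λ a b c d → (a :- b) :+ (c :- d) := (a :+ c) :- (b :+ d)) refl
      (x m) (x n) (y m) (y n))
    (∣+∣<halves (x m ℚ.- x n) (y m ℚ.- y n)
      (xclose m n (ℕ.m⊔n≤o⇒m≤o M N m≥) (ℕ.m⊔n≤o⇒m≤o M N n≥))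
      (yclose m n (ℕ.m⊔n≤o⇒n≤o M N m≥) (ℕ.m⊔n≤o⇒n≤o M N n≥)))
  where open +-*-Solver

-ᴿ_ : ℝ → ℝ
approx (-ᴿ mkℝ x _) n = ℚ.- x n
cauchy (-ᴿ mkℝ x cx) δ 0<δ with cx δ 0<δ
... | N , close = N , λ m n m≥ n≥ →
  subst (λ z → ℚ.∣ z ∣ ℚ.< δ)
    (solve 2 (λ a b → b :- a := (:- a) :- (:- b)) refl (x m) (x n))
    (close n m n≥ m≥)
  where open +-*-Solver

_-ᴿ_ : ℝ → ℝ → ℝ
x -ᴿ y = x +ᴿ (-ᴿ y)

_*ᴿ_ : ℝ → ℝ → ℝ
mkℝ x cx *ᴿ mkℝ y cy = mkℝ (λ n → x n ℚ.* y n) (*-cauchy x y cx cy)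

sumᴿ : List ℝ → ℝ
sumᴿ = foldr _+ᴿ_ 0ᴿ

√-step : ℕ → ℕ → ℕ
√-step n r with suc r ℕ.* suc r ℕ.≤? n
... | yes _ = suc r
... | no _ = r

⌊√_⌋ : ℕ → ℕ
⌊√ zero ⌋ = 0
⌊√ suc n ⌋ = √-step (suc n) ⌊√ n ⌋

private
  √-step-lower : ∀ n r → r ℕ.* r ℕ.≤ n → √-step n r ℕ.* √-step n r ℕ.≤ n
  √-step-lower n r r²≤n with suc r ℕ.* suc r ℕ.≤? n
  ... | yes r′²≤n = r′²≤n
  ... | no _ = r²≤n

  √-step-upper : ∀ n r → n ℕ.< suc r ℕ.* suc r →
                 suc n ℕ.< suc (√-step (suc n) r) ℕ.* suc (√-step (suc n) r)
  √-step-upper n r n<r′² with suc r ℕ.* suc r ℕ.≤? suc n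
  ... | yes _ = ℕ.≤-<-trans n<r′² (ℕ.*-mono-< (ℕ.n<1+n (suc r)) (ℕ.n<1+n (suc r)))
  ... | no r′²≰n = ℕ.≰⇒> r′²≰n

⌊√⌋-lower : ∀ n → ⌊√ n ⌋ ℕ.* ⌊√ n ⌋ ℕ.≤ n
⌊√⌋-lower zero = ℕ.z≤n
⌊√⌋-lower (suc n) = √-step-lower (suc n) ⌊√ n ⌋ (ℕ.m≤n⇒m≤1+n (⌊√⌋-lower n))

⌊√⌋-upper : ∀ n → n ℕ.< suc ⌊√ n ⌋ ℕ.* suc ⌊√ n ⌋
⌊√⌋-upper zero = ℕ.s≤s ℕ.z≤n
⌊√⌋-upper (suc n) = √-step-upper n ⌊√ n ⌋ (⌊√⌋-upper n)

-- ⌊ (n + 1) √ d ⌋ / (n + 1)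
√-approx : ℕ → ℕ → ℚ
√-approx d n = + ⌊√ d ℕ.* (suc n ℕ.* suc n) ⌋ ℚ./ suc n

private
  square-cancel-< : ∀ {a b} → a ℕ.* a ℕ.< b ℕ.* b → a ℕ.< b
  square-cancel-< {a} {b} a²<b² =
    ℕ.≰⇒> λ b≤a → ℕ.<⇒≱ a²<b² (ℕ.*-mono-≤ b≤a b≤a)

  /-mono-< : ∀ a b m n → a ℕ.* suc n ℕ.< b ℕ.* suc m → + a ℚ./ suc m ℚ.< + b ℚ./ suc n
  /-mono-< a b m n a<b = ℚ.toℚᵘ-cancel-<
    (ℚᵘ.<-respˡ-≃ (ℚᵘ.≃-sym (ℚ.toℚᵘ-fromℚᵘ (ℚᵘ.mkℚᵘ (+ a) m)))
      (ℚᵘ.<-respʳ-≃ (ℚᵘ.≃-sym (ℚ.toℚᵘ-fromℚᵘ (ℚᵘ.mkℚᵘ (+ b) n)))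
        (ℚᵘ.*<* (subst₂ ℤ._<_ (ℤ.pos-* a (suc n)) (ℤ.pos-* b (suc m)) (ℤ.+<+ a<b)))))

  /-suc : ∀ b n → + suc b ℚ./ suc n ≡ + 1 ℚ./ suc n ℚ.+ + b ℚ./ suc n
  /-suc b n = ℚ.toℚᵘ-injective (begin
    ℚ.toℚᵘ (+ suc b ℚ./ suc n)
      ≈⟨ ℚ.toℚᵘ-fromℚᵘ (ℚᵘ.mkℚᵘ (+ suc b) n) ⟩
    ℚᵘ.mkℚᵘ (+ suc b) n
      ≈⟨ ℚᵘ.*≡* (aux (+ b) (+ suc n)) ⟩
    ℚᵘ.mkℚᵘ (+ 1) n ℚᵘ.+ ℚᵘ.mkℚᵘ (+ b) n
      ≈⟨ ℚᵘ.+-cong (ℚ.toℚᵘ-fromℚᵘ (ℚᵘ.mkℚᵘ (+ 1) n)) (ℚ.toℚᵘ-fromℚᵘ (ℚᵘ.mkℚᵘ (+ b) n)) ⟨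
    ℚ.toℚᵘ (+ 1 ℚ./ suc n) ℚᵘ.+ ℚ.toℚᵘ (+ b ℚ./ suc n)
      ≈⟨ ℚ.toℚᵘ-homo-+ (+ 1 ℚ./ suc n) (+ b ℚ./ suc n) ⟨
    ℚ.toℚᵘ (+ 1 ℚ./ suc n ℚ.+ + b ℚ./ suc n) ∎)
    where
    open import Relation.Binary.Reasoning.Setoid ℚᵘ.≃-setoid

    aux : ∀ i k → (ℤ.1ℤ ℤ.+ i) ℤ.* (k ℤ.* k) ≡ (ℤ.1ℤ ℤ.* k ℤ.+ i ℤ.* k) ℤ.* k
    aux = solve-∀

  √-approx-close : ∀ d m n → √-approx d m ℚ.- √-approx d n ℚ.< + 1 ℚ./ suc n
  √-approx-close d m n = subst₂ ℚ._<_ refl (cancel (+ 1 ℚ./ suc n) (√-approx d n))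
    (ℚ.+-monoˡ-< (ℚ.- √-approx d n)
      (subst (√-approx d m ℚ.<_) (/-suc b n) (/-mono-< a (suc b) m n
        (square-cancel-< (subst₂ ℕ._<_ (swap a n) (swap (suc b) m) below)))))
    where
    open ℕ.≤-Reasoning
    a b : ℕ
    a = ⌊√ d ℕ.* (suc m ℕ.* suc m) ⌋
    b = ⌊√ d ℕ.* (suc n ℕ.* suc n) ⌋

    swap : ∀ a n → (a ℕ.* a) ℕ.* (suc n ℕ.* suc n) ≡ (a ℕ.* suc n) ℕ.* (a ℕ.* suc n)
    swap a n = ℕ.[m*n]*[o*p]≡[m*o]*[n*p] a a (suc n) (suc n)

    cancel : ∀ p q → p ℚ.+ q ℚ.- q ≡ p
    cancel = solve 2 (λ p q → p :+ q :- q := p) refl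
      where open +-*-Solver

    below : (a ℕ.* a) ℕ.* (suc n ℕ.* suc n) ℕ.< (suc b ℕ.* suc b) ℕ.* (suc m ℕ.* suc m)
    below = begin-strict
      (a ℕ.* a) ℕ.* (suc n ℕ.* suc n)
        ≤⟨ ℕ.*-monoˡ-≤ (suc n ℕ.* suc n) (⌊√⌋-lower (d ℕ.* (suc m ℕ.* suc m))) ⟩
      d ℕ.* (suc m ℕ.* suc m) ℕ.* (suc n ℕ.* suc n)
        ≡⟨ ℕ.*-assoc d (suc m ℕ.* suc m) (suc n ℕ.* suc n) ⟩
      d ℕ.* ((suc m ℕ.* suc m) ℕ.* (suc n ℕ.* suc n))
        ≡⟨ cong (d ℕ.*_) (ℕ.*-comm (suc m ℕ.* suc m) (suc n ℕ.* suc n)) ⟩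
      d ℕ.* ((suc n ℕ.* suc n) ℕ.* (suc m ℕ.* suc m))
        ≡⟨ ℕ.*-assoc d (suc n ℕ.* suc n) (suc m ℕ.* suc m) ⟨
      d ℕ.* (suc n ℕ.* suc n) ℕ.* (suc m ℕ.* suc m)
        <⟨ ℕ.*-monoˡ-< (suc m ℕ.* suc m) (⌊√⌋-upper (d ℕ.* (suc n ℕ.* suc n))) ⟩
      (suc b ℕ.* suc b) ℕ.* (suc m ℕ.* suc m) ∎

  archimedean : ∀ δ → 0ℚ ℚ.< δ → ∃ λ N → ∀ n → N ℕ.≤ n → + 1 ℚ./ suc n ℚ.≤ δ
  archimedean (mkℚ (+ zero) _ _) (ℚ.*<* (ℤ.+<+ ()))
  archimedean (mkℚ ℤ.-[1+ _ ] _ _) (ℚ.*<* ())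
  archimedean (mkℚ (+ suc p) e _) _ = e , λ n e≤n → ℚ.toℚᵘ-cancel-≤
    (ℚᵘ.≤-respˡ-≃ (ℚᵘ.≃-sym (ℚ.toℚᵘ-fromℚᵘ (ℚᵘ.mkℚᵘ (+ 1) n)))
      (ℚᵘ.*≤* (subst₂ ℤ._≤_ (ℤ.pos-* 1 (suc e)) (ℤ.pos-* (suc p) (suc n))
        (ℤ.+≤+ (ℕ.*-mono-≤ {1} {suc p} (ℕ.s≤s ℕ.z≤n) (ℕ.s≤s e≤n))))))

  √-cauchy : ∀ d → IsCauchy (√-approx d)
  √-cauchy d δ 0<δ with archimedean δ 0<δ
  ... | N , small = N , λ m n m≥ n≥ →
    bound (√-approx d m) (√-approx d n)
      (ℚ.<-≤-trans (√-approx-close d m n) (small n n≥))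
      (ℚ.<-≤-trans (√-approx-close d n m) (small m m≥))
    where
    negate : ∀ p q → q ℚ.- p ≡ ℚ.- (p ℚ.- q)
    negate = solve 2 (λ p q → q :- p := :- (p :- q)) refl
      where open +-*-Solver

    bound : ∀ p q → p ℚ.- q ℚ.< δ → q ℚ.- p ℚ.< δ → ℚ.∣ p ℚ.- q ∣ ℚ.< δ
    bound p q p-q<δ q-p<δ with ℚ.∣p∣≡p∨∣p∣≡-p (p ℚ.- q)
    ... | inj₁ eq = subst (ℚ._< δ) (sym eq) p-q<δ
    ... | inj₂ eq = subst (ℚ._< δ) (trans (negate p q) (sym eq)) q-p<δ

√_ : ℕ → ℝ
√ d = mkℝ (√-approx d) (√-cauchy d)

-- The limit inferior is sup_N inf_{n ≥ N} a n, an extended real; it is at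
-- least x exactly when every y < x is a lower bound of some tail of a.
liminf_≥_ : (ℕ → ℝ) → ℝ → Set
liminf a ≥ x = ∀ y → y <ᴿ x → Eventually λ n → y ≤ᴿ a n

data DecisionTree (I O : Set) : Set where
  output : O → DecisionTree I O
  query  : I → (Bool → DecisionTree I O) → DecisionTree I O

module _ {I O : Set} where

  run : DecisionTree I O → (I → Bool) → O
  run (output o)  x = o
  run (query i t) x = run (t (x i)) x

  queries : DecisionTree I O → (I → Bool) → ℕ
  queries (output o)  x = 0
  queries (query i t) x = suc (queries (t (x i)) x)

-- Finite support loses no generality: up to queries repeated along a branch,
-- only finitely many decision trees make a bounded number of queries.
record RandomizedAlgorithm (I O : Set) : Set where
  field
    outcomes    : List (ℝ × DecisionTree I O)
    nonNegative : All (λ (p , _) → 0ᴿ ≤ᴿ p) outcomes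
    total       : sumᴿ (map proj₁ outcomes) ≈ᴿ 1ᴿ

open RandomizedAlgorithm public

IsMinimum : (ℕ → Set) → ℕ → Set
IsMinimum P m = P m × (∀ k → P k → m ℕ.≤ k)

-- X is the set of inputs, I the set of bit positions, and bit x i the bit
-- of x at position i.
module _ {X I O : Set} (bit : X → I → Bool) (g : X → O) where

  IsDeterministicComplexity : ℕ → Set
  IsDeterministicComplexity = IsMinimum λ q → ∃ λ (t : DecisionTree I O) →
    (∀ x → run t (bit x) ≡ g x) × (∀ x → queries t (bit x) ℕ.≤ q)

  module _ (_≟_ : DecidableEquality O) where

    successProbability : RandomizedAlgorithm I O → X → ℝ
    successProbability A x =
      sumᴿ (map proj₁ (filter (λ (_ , t) → run t (bit x) ≟ g x) (outcomes A)))

    IsRandomizedComplexity : ℝ → ℕ → Set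
    IsRandomizedComplexity ε = IsMinimum λ q → ∃ λ (A : RandomizedAlgorithm I O) →
      (∀ x → 1ᴿ -ᴿ ε ≤ᴿ successProbability A x) ×
      All (λ (_ , t) → ∀ x → queries t (bit x) ℕ.≤ q) (outcomes A)

Bits : ℕ → Set
Bits = Vec Bool

infixl 8 _^⊗_

_^⊗_ : ∀ {m} {Z : Set} → (Bits m → Z) → ∀ n → Vec (Bits m) n → Vec Z n
(f ^⊗ n) xs = Vec.map f xs

module _ {m : ℕ} {Z : Set} (f : Bits m → Z) where

  D≡ : ℕ → Set
  D≡ d = IsDeterministicComplexity lookup f d

  -- R_ε(fⁿ) = r; finiteness of Z supplies the decidable equality of outputs.
  R^⊗≡ : ∀ {k} → Z ↔ Fin k → ℝ → ℕ → ℕ → Set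
  R^⊗≡ Z-finite ε n r = IsRandomizedComplexity
    {X = Vec (Bits m) n} {I = Fin n × Fin m} (λ xs (i , j) → lookup (lookup xs i) j) (f ^⊗ n)
    (Vec.≡-dec (inj⇒≟ (↔⇒↣ Z-finite))) ε r

-- Let s be the largest certificate complexity of f at any input. Querying the
-- certificates of two inputs with different values shortens by one the certificate of
-- every input that is still possible, so D(f) ≤ s (s + 1) ≤ (2 s)².
--
-- Let x be an input without certificates of size below s. Draw the n inputs of fⁿ
-- independently, with weight N + s on x and s on every other input, and track the product
-- over the coordinates of a potential: the weight of the inputs still possible, reduced by
-- r while the answers agree with x and r more queries are needed for a certificate. At a
-- leaf the potential bounds the weight of the correctly answered inputs, because a weight
-- of at least s ≥ r belongs to another value of f. Summed over the two answers to a query,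
-- it grows by a factor of at most 1 + 1/N, and s n / 4 such factors do not make up for the
-- initial reduction by s in each coordinate, so the success probability tends to 0 as n
-- grows. As f is fixed while n → ∞, this contradicts success probability 1 - ε, whatever
-- ε < 1 is; hence R_ε(fⁿ) ≥ s n / 4 ≥ n √D(f) / 8 for large n.
module Submission where

open import Algebra.Bundles using (CommutativeRing)
import Algebra.Properties.Semiring.Mult as SemiringMult
open import Data.Bool.Base using (Bool; true; false; if_then_else_; not)
import Data.Bool.Properties as Bool
open import Data.Empty using (⊥-elim)
open import Data.Fin.Base as Fin using (Fin)
open import Data.Fin.Properties as Fin using (inj⇒≟)
open import Data.Fin.Subset.Properties using (anySubset?)
import Data.Integer.Base as ℤ
import Data.Integer.Properties as ℤ
import Data.Integer.Tactic.RingSolver as ℤ-Solver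
open import Data.List.Base as List
  using (List; []; _∷_; _++_; cartesianProductWith; filter; length)
import Data.List.Membership.DecPropositional as DecMembership
open import Data.List.Membership.Propositional using (_∈_; find; lose)
open import Data.List.Membership.Propositional.Properties
  using (∈-++⁺ˡ; ∈-++⁺ʳ; ∈-allFin; ∈-cartesianProductWith⁺; ∈-filter⁺)
import Data.List.Properties as List
open import Data.List.Relation.Unary.All as All using (All; []; _∷_)
open import Data.List.Relation.Unary.Any using (any?; here; there)
open import Data.Nat.Base hiding (_/_)
import Data.Nat.Properties as ℕ
open import Data.Nat.Tactic.RingSolver using (solve-∀)
open import Data.Product.Base using (∃; ∃₂; _×_; _,_; proj₁; proj₂)
open import Data.Rational.Base as ℚ using (ℚ; mkℚ; 0ℚ; 1ℚ; ½; _/_)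
import Data.Rational.Properties as ℚ
open import Data.Rational.Solver using (module +-*-Solver)
import Data.Rational.Unnormalised.Base as ℚᵘ
import Data.Rational.Unnormalised.Properties as ℚᵘ
open import Data.Sum.Base using (_⊎_; inj₁; inj₂; swap)
open import Data.Unit.Base using (⊤; tt)
open import Data.Vec.Base as Vec
  using (Vec; []; _∷_; lookup; replicate; tabulate; updateAt; zipWith; _[_]≔_)
import Data.Vec.Properties as Vec
open import Data.Vec.Relation.Binary.Pointwise.Extensional using (ext; Pointwise-≡⇒≡)
open import Data.Vec.Relation.Binary.Pointwise.Inductive using (Pointwise; []; _∷_)
open import Function.Base using (_∘_; id)
open import Function.Bundles using (_↔_)
open import Function.Properties.Inverse using (↔⇒↣)
open import Level using (0ℓ)
open import Relation.Binary.Definitions using (DecidableEquality)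
open import Relation.Binary.PropositionalEquality
  using (_≡_; _≢_; _≗_; refl; sym; trans; cong; cong₂; subst; subst₂)
open import Relation.Nullary using (contradiction)
open import Relation.Nullary.Decidable using (yes; no; does; _×-dec_; ¬?)
open import Relation.Unary using (Pred; Decidable; U; _∩_; _⊆_)
open import Defs

open SemiringMult (CommutativeRing.semiring ℚ.+-*-commutativeRing)
  using (×-homo-+; ×1-homo-*) renaming (_×_ to _×ℚ_)

-- Certificates and deterministic query complexity

Agree : ∀ {m} → Bits m → List (Fin m) → Pred (Bits m) 0ℓ
Agree x L y = All (λ i → lookup y i ≡ lookup x i) L

agree? : ∀ {m} (x : Bits m) L → Decidable (Agree x L)
agree? x L y = All.all? (λ i → lookup y i Bool.≟ lookup x i) L

-- Convexity in the Hamming metric. Subcubes have it, and it admits the hybrid of two inputs that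
-- `certificates-meet` builds.
Convex : ∀ {m} → Pred (Bits m) 0ℓ → Set
Convex P = ∀ x y z → P x → P y →
  (∀ i → lookup z i ≡ lookup x i ⊎ lookup z i ≡ lookup y i) → P z

∩-convex : ∀ {m} {P Q : Pred (Bits m) 0ℓ} → Convex P → Convex Q → Convex (P ∩ Q)
∩-convex cP cQ x y z (Px , Qx) (Py , Qy) mixed = cP x y z Px Py mixed , cQ x y z Qx Qy mixed

agree-convex : ∀ {m} (x : Bits m) L → Convex (Agree x L)
agree-convex c [] x y z [] [] mixed = []
agree-convex c (i ∷ L) x y z (ai ∷ as) (bi ∷ bs) mixed with mixed i
... | inj₁ eq = trans eq ai ∷ agree-convex c L x y z as bs mixed
... | inj₂ eq = trans eq bi ∷ agree-convex c L x y z as bs mixed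

-- Finite search with a pointwise disjunction in place of a decision procedure; `hard-or-certified`
-- supplies such a disjunction by recursion.
fin-all-or-any : ∀ {n} {A B : Pred (Fin n) 0ℓ} →
  (∀ i → A i ⊎ B i) → (∀ i → A i) ⊎ ∃ B
fin-all-or-any {zero} _ = inj₁ λ ()
fin-all-or-any {suc n} A⊎B with A⊎B Fin.zero | fin-all-or-any (A⊎B ∘ Fin.suc)
... | inj₂ b | _ = inj₂ (Fin.zero , b)
... | inj₁ _ | inj₂ (i , b) = inj₂ (Fin.suc i , b)
... | inj₁ a | inj₁ as = inj₁ λ where
  Fin.zero → a
  (Fin.suc i) → as i

bits-all-or-any : ∀ {m} {A B : Pred (Bits m) 0ℓ} →
  (∀ x → A x ⊎ B x) → (∀ x → A x) ⊎ ∃ B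
bits-all-or-any {zero} A⊎B with A⊎B []
... | inj₁ a = inj₁ λ where [] → a
... | inj₂ b = inj₂ ([] , b)
bits-all-or-any {suc m} A⊎B
  with bits-all-or-any (A⊎B ∘ (false ∷_)) | bits-all-or-any (A⊎B ∘ (true ∷_))
... | inj₂ (x , b) | _ = inj₂ (false ∷ x , b)
... | inj₁ _ | inj₂ (x , b) = inj₂ (true ∷ x , b)
... | inj₁ as | inj₁ bs = inj₁ λ where
  (false ∷ x) → as x
  (true ∷ x) → bs x

module _ {m : ℕ} {Z : Set} (f : Bits m → Z) where

  Certifies : Pred (Bits m) 0ℓ → Bits m → List (Fin m) → Set
  Certifies P x L = ∀ y → P y → Agree x L y → f y ≡ f x

  Certifiable : Pred (Bits m) 0ℓ → ℕ → Set
  Certifiable P a = ∀ x → P x → ∃ λ L → length L ≤ a × Certifies P x L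

  Computable : Pred (Bits m) 0ℓ → ℕ → Set
  Computable P q = ∃ λ (t : DecisionTree (Fin m) Z) →
    ∀ x → P x → run t (lookup x) ≡ f x × queries t (lookup x) ≤ q

  computable-mono : ∀ {P Q p q} → Q ⊆ P → p ≤ q → Computable P p → Computable Q q
  computable-mono Q⊆P p≤q (t , correct) =
    t , λ x Qx → let eq , le = correct x (Q⊆P Qx) in eq , ℕ.≤-trans le p≤q

  -- The answers are collected in `a`, which matters only on `L`. A position listed twice does no
  -- harm: the value written over it is the bit that `x` has there, which is what `extend` checks.
  queryAll : ∀ L {P q} → (∀ a → Computable (P ∩ Agree a L) q) → Computable P (length L + q)
  -- Nothing has been asked, so any vector can stand for the record of answers.
  queryAll [] cont = computable-mono (_, []) ℕ.≤-refl (cont (Vec.replicate m false))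
  queryAll (i ∷ L) {P} {q} cont = query i (proj₁ ∘ branch) , λ x Px →
    let eq , le = proj₂ (branch (lookup x i)) x (Px , refl) in eq , s≤s le
    where
    extend : ∀ a b x → lookup x i ≡ b → ∀ {L} → Agree a L x → Agree (a [ i ]≔ b) L x
    extend a b x xi≡b = All.map agree
      where
      agree : ∀ {k} → lookup x k ≡ lookup a k → lookup x k ≡ lookup (a [ i ]≔ b) k
      agree {k} eq with k Fin.≟ i
      ... | yes refl = trans xi≡b (sym (Vec.lookup∘updateAt i a))
      ... | no k≢i = trans eq (sym (Vec.lookup∘updateAt′ k i k≢i a))

    branch : ∀ b → Computable (P ∩ λ x → lookup x i ≡ b) (length L + q)
    branch b = queryAll L λ a → computable-mono
      (λ {x} ((Px , xi≡b) , agree) → Px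
        , trans xi≡b (sym (Vec.lookup∘updateAt i a)) ∷ extend a b x xi≡b agree)
      ℕ.≤-refl (cont (a [ i ]≔ b))

  -- Were no position shared, the input with the bits of `y` on `K` and those of `x` elsewhere would
  -- satisfy both certificates, forcing `f x ≡ f y`. Convexity keeps this hybrid in `P`.
  certificates-meet : ∀ {P L K} x y → Convex P → P x → P y → f x ≢ f y →
    Certifies P x L → Certifies P y K → ∃ λ i → i ∈ L × i ∈ K
  certificates-meet {P} {L} {K} x y convex Px Py fx≢fy certL certK
    with any? (_∈? K) L
    where open DecMembership Fin._≟_ using (_∈?_)
  ... | yes meet = find meet
    where open import Data.List.Membership.Propositional using (find)
  ... | no disjoint = ⊥-elim (fx≢fy (trans (sym (certL z Pz z~x)) (certK z Pz z~y)))
    where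
    open DecMembership Fin._≟_ using (_∈?_)
    choose : Fin m → Bool
    choose i = if does (i ∈? K) then lookup y i else lookup x i

    z : Bits m
    z = tabulate choose

    mixed : ∀ i → lookup z i ≡ lookup x i ⊎ lookup z i ≡ lookup y i
    mixed i with i ∈? K | Vec.lookup∘tabulate choose i
    ... | yes _ | eq = inj₂ eq
    ... | no _ | eq = inj₁ eq

    Pz : P z
    Pz = convex x y z Px Py mixed

    z~x : Agree x L z
    z~x = All.tabulate λ {i} i∈L → agree i i∈L
      where
      agree : ∀ i → i ∈ L → lookup z i ≡ lookup x i
      agree i i∈L with i ∈? K | Vec.lookup∘tabulate choose i
      ... | yes i∈K | _ = ⊥-elim (disjoint (lose i∈L i∈K))
      ... | no _ | eq = eq

    z~y : Agree y K z
    z~y = All.tabulate λ {i} i∈K → agree i i∈K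
      where
      agree : ∀ i → i ∈ K → lookup z i ≡ lookup y i
      agree i i∈K with i ∈? K | Vec.lookup∘tabulate choose i
      ... | yes _ | eq = eq
      ... | no i∉K | _ = ⊥-elim (i∉K i∈K)

  -- Once the bits in `K` are known, every remaining input has the same bit as `x` at the common
  -- position `i`, so the certificate stays valid without it. Removing all occurrences of `i` saves
  -- at least one entry.
  drop-known : ∀ {P L K i a} c x → i ∈ L → i ∈ K → length L ≤ suc a → Certifies P x L →
    Agree c K x → ∃ λ L′ → length L′ ≤ a × Certifies (P ∩ Agree c K) x L′
  drop-known {P} {L} {K} {i} c x i∈L i∈K short cert x~c =
    filter other? L , ℕ.≤-pred (ℕ.<-≤-trans shorter short) , λ y (Py , y~c) y~x →
      cert y Py (All.tabulate (agree y y~c y~x))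
    where
    other? : Decidable (_≢ i)
    other? k = ¬? (k Fin.≟ i)

    shorter : length (filter other? L) < length L
    shorter = List.filter-notAll other? L (lose i∈L (λ i≢i → i≢i refl))

    agree : ∀ y → Agree c K y → Agree x (filter other? L) y →
            ∀ {k} → k ∈ L → lookup y k ≡ lookup x k
    agree y y~c y~x {k} k∈L with k Fin.≟ i
    ... | yes refl = trans (All.lookup y~c i∈K) (sym (All.lookup x~c i∈K))
    ... | no k≢i = All.lookup y~x (∈-filter⁺ other? k∈L k≢i)

  module _ (_≟_ : DecidableEquality Z) where

    -- Query the certificates of two inputs with different values; every remaining
    -- input differs in value from one of them, so its certificate loses a position.
    certifiable⇒computable : ∀ a {P} → Decidable P → Convex P →
      Certifiable P a → Computable P (a * suc a)
    certifiable⇒computable a {P} P? convex certs with anySubset? P?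
    ... | no empty = output (f (Vec.replicate m false)) , λ x Px → ⊥-elim (empty (x , Px))
    ... | yes (x , Px) with anySubset? (λ y → P? y ×-dec ¬? (f x ≟ f y))
    ... | no constant = output (f x) , λ y Py → value y Py , z≤n
      where
      value : ∀ y → P y → f x ≡ f y
      value y Py with f x ≟ f y
      ... | yes eq = eq
      ... | no fx≢fy = ⊥-elim (constant (y , Py , fx≢fy))
    ... | yes (y , Py , fx≢fy) with certs x Px | certs y Py
    -- An empty certificate would make `f` constant on `P`.
    certifiable⇒computable zero _ _ _ | yes _ | yes (y , Py , fx≢fy)
      | [] , _ , certK | _ = ⊥-elim (fx≢fy (sym (certK y Py [])))
    certifiable⇒computable (suc a) {P} P? convex certs | yes (x , Px) | yes (y , Py , fx≢fy)
      | K , K≤ , certK | L , L≤ , certL =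
      computable-mono id bound (queryAll (K ++ L) λ c →
        certifiable⇒computable a (λ z → P? z ×-dec agree? c (K ++ L) z)
          (∩-convex convex (agree-convex c (K ++ L))) (remaining c))
      where
      bound : length (K ++ L) + a * suc a ≤ suc a * suc (suc a)
      bound = begin
        length (K ++ L) + a * suc a       ≡⟨ cong (_+ a * suc a) (List.length-++ K) ⟩
        length K + length L + a * suc a   ≤⟨ ℕ.+-monoˡ-≤ (a * suc a) (ℕ.+-mono-≤ K≤ L≤) ⟩
        suc a + suc a + a * suc a         ≡⟨ arith a ⟩
        suc a * suc (suc a)               ∎
        where
        open ℕ.≤-Reasoning
        arith : ∀ a → suc a + suc a + a * suc a ≡ suc a * suc (suc a)
        arith = solve-∀

      remaining : ∀ c → Certifiable (P ∩ Agree c (K ++ L)) a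
      remaining c z (Pz , z~c) with certs z Pz | f z ≟ f x
      ... | M , M≤ , certM | no fz≢fx =
        let i , i∈M , i∈K = certificates-meet z x convex Pz Px fz≢fx certM certK
        in drop-known c z i∈M (∈-++⁺ˡ i∈K) M≤ certM z~c
      ... | M , M≤ , certM | yes fz≡fx =
        let i , i∈M , i∈L = certificates-meet z y convex Pz Py (fx≢fy ∘ trans (sym fz≡fx)) certM certL
        in drop-known c z i∈M (∈-++⁺ʳ K i∈L) M≤ certM z~c

    -- Hard x r K: when the positions in K are known to agree with x, fewer than r
    -- further positions never certify the value at x.
    Hard : Bits m → ℕ → List (Fin m) → Set
    Hard x zero    K = ⊤
    Hard x (suc r) K = (∃ λ y → Agree x K y × f x ≢ f y) × (∀ i → Hard x r (i ∷ K))

    -- Hardness fails at `suc r` in one of two ways: `f` is constant on the inputs agreeing with `x`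
    -- on `K`, which the empty list certifies, or some further position `i` leaves a certificate of
    -- length below `r`, to which `i` is prepended.
    hard-or-certified : ∀ x r K →
      Hard x r K ⊎ ∃ λ L → length L < r × Certifies (Agree x K) x L
    hard-or-certified x zero K = inj₁ tt
    hard-or-certified x (suc r) K
      with anySubset? (λ y → agree? x K y ×-dec ¬? (f x ≟ f y))
    ... | no constant = inj₂ ([] , s≤s z≤n , λ y y~x _ → value y y~x)
      where
      value : ∀ y → Agree x K y → f y ≡ f x
      value y y~x with f x ≟ f y
      ... | yes eq = sym eq
      ... | no fx≢fy = ⊥-elim (constant (y , y~x , fx≢fy))
    ... | yes witness with fin-all-or-any (λ i → hard-or-certified x r (i ∷ K))
    ... | inj₁ hard = inj₁ (witness , hard)
    ... | inj₂ (i , L , L< , cert) = inj₂ (i ∷ L , s≤s L< , λ where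
      y y~x (yi≡xi ∷ y~x′) → cert y (yi≡xi ∷ y~x) y~x′)

    -- Descent from `m`, where all positions together certify: as long as every input has a
    -- certificate shorter than `s`, lower `s`. The descent stops at an input that is hard for `s`,
    -- or at 0, where `f` is constant.
    certificate-complexity : ∃ λ s →
      Certifiable U s × (s ≡ 0 ⊎ ∃ λ x → Hard x s [])
    certificate-complexity = least m λ x _ → List.allFin m
      , ℕ.≤-reflexive (List.length-tabulate id)
      , λ y _ y~x → cong f (agree-everywhere x y y~x)
      where
      agree-everywhere : ∀ x y → Agree x (List.allFin m) y → y ≡ x
      agree-everywhere x y y~x = Pointwise-≡⇒≡ (ext λ i → All.lookup y~x (∈-allFin i))

      least : ∀ s → Certifiable U s →
        ∃ λ s → Certifiable U s × (s ≡ 0 ⊎ ∃ λ x → Hard x s [])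
      least zero certs = zero , certs , inj₁ refl
      least (suc s) certs with bits-all-or-any (λ x → swap (hard-or-certified x (suc s) []))
      ... | inj₁ smaller = least s λ x _ →
        let L , L< , cert = smaller x in L , ℕ.≤-pred L< , λ y _ → cert y []
      ... | inj₂ hard = suc s , certs , inj₂ hard

    deterministic-upper-bound : ∀ {d s} → D≡ f d → Certifiable U s → d ≤ s * suc s
    deterministic-upper-bound {d} {s} (_ , minimal) certs =
      let t , correct = certifiable⇒computable s (λ _ → yes tt) (λ _ _ _ _ _ _ → tt) certs
      in minimal (s * suc s) (t , (λ x → proj₁ (correct x tt)) , λ x → proj₂ (correct x tt))

-- Weighted sums over enumerated inputs

variable
  A B C : Set

∑ : List A → (A → ℕ) → ℕ
∑ xs g = List.foldr (λ x → g x +_) 0 xs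

∏ : ∀ {n} → Vec ℕ n → ℕ
∏ = Vec.foldr′ _*_ 1

∑-mono : ∀ xs {g h : A → ℕ} → (∀ x → g x ≤ h x) → ∑ xs g ≤ ∑ xs h
∑-mono [] g≤h = z≤n
∑-mono (x ∷ xs) g≤h = ℕ.+-mono-≤ (g≤h x) (∑-mono xs g≤h)

∑-cong : ∀ xs {g h : A → ℕ} → g ≗ h → ∑ xs g ≡ ∑ xs h
∑-cong [] g≗h = refl
∑-cong (x ∷ xs) g≗h = cong₂ _+_ (g≗h x) (∑-cong xs g≗h)

∑-+ : ∀ xs (g h : A → ℕ) → ∑ xs (λ x → g x + h x) ≡ ∑ xs g + ∑ xs h
∑-+ [] g h = refl
∑-+ (x ∷ xs) g h = trans (cong (g x + h x +_) (∑-+ xs g h))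
  (interchange (g x) (h x) (∑ xs g) (∑ xs h))
  where
  interchange : ∀ a b c d → a + b + (c + d) ≡ a + c + (b + d)
  interchange = solve-∀

∑-*ˡ : ∀ c xs (g : A → ℕ) → ∑ xs (λ x → c * g x) ≡ c * ∑ xs g
∑-*ˡ c [] g = sym (ℕ.*-zeroʳ c)
∑-*ˡ c (x ∷ xs) g = trans (cong (c * g x +_) (∑-*ˡ c xs g))
  (sym (ℕ.*-distribˡ-+ c (g x) (∑ xs g)))

∑-*ʳ : ∀ c xs (g : A → ℕ) → ∑ xs (λ x → g x * c) ≡ ∑ xs g * c
∑-*ʳ c xs g = trans (∑-cong xs (λ x → ℕ.*-comm (g x) c))
  (trans (∑-*ˡ c xs g) (ℕ.*-comm c (∑ xs g)))

∑-zero : ∀ xs {g : A → ℕ} → (∀ x → g x ≡ 0) → ∑ xs g ≡ 0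
∑-zero xs {g} g≗0 = trans (∑-cong xs g≗0) (∑-*ˡ 0 xs g)

∑-point : ∀ {x xs} (g : A → ℕ) → x ∈ xs → g x ≤ ∑ xs g
∑-point g (here refl) = ℕ.m≤m+n (g _) _
∑-point {xs = y ∷ _} g (there x∈xs) = ℕ.≤-trans (∑-point g x∈xs) (ℕ.m≤n+m _ (g y))

∑-++ : ∀ xs ys (g : A → ℕ) → ∑ (xs ++ ys) g ≡ ∑ xs g + ∑ ys g
∑-++ [] ys g = refl
∑-++ (x ∷ xs) ys g = trans (cong (g x +_) (∑-++ xs ys g))
  (sym (ℕ.+-assoc (g x) (∑ xs g) (∑ ys g)))

∑-map : ∀ (f : B → A) xs g → ∑ (List.map f xs) g ≡ ∑ xs (g ∘ f)
∑-map f [] g = refl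
∑-map f (x ∷ xs) g = cong (g (f x) +_) (∑-map f xs g)

∑-cartesianProductWith : ∀ (f : B → C → A) xs ys g →
  ∑ (cartesianProductWith f xs ys) g ≡ ∑ xs (λ x → ∑ ys (λ y → g (f x y)))
∑-cartesianProductWith f [] ys g = refl
∑-cartesianProductWith f (x ∷ xs) ys g = trans
  (∑-++ (List.map (f x) ys) _ g)
  (cong₂ _+_ (∑-map (f x) ys g) (∑-cartesianProductWith f xs ys g))

vecs : List A → ∀ n → List (Vec A n)
vecs xs zero = [] ∷ []
vecs xs (suc n) = cartesianProductWith _∷_ xs (vecs xs n)

∈-vecs : ∀ {xs} → (∀ x → x ∈ xs) → ∀ {n} (v : Vec A n) → v ∈ vecs xs n
∈-vecs ∈-xs [] = here refl
∈-vecs ∈-xs (x ∷ v) = ∈-cartesianProductWith⁺ _∷_ (∈-xs x) (∈-vecs ∈-xs v)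

weight : ∀ {n} → Vec (A → ℕ) n → Vec A n → ℕ
weight ws v = ∏ (zipWith (λ w x → w x) ws v)

-- `weight ws` is an unnormalised product measure, and this is the discrete Fubini theorem for it.
∑-weight : ∀ xs {n} (ws : Vec (A → ℕ) n) →
  ∑ (vecs xs n) (weight ws) ≡ ∏ (Vec.map (∑ xs) ws)
∑-weight xs [] = refl
∑-weight xs {suc n} (w ∷ ws) = begin-equality
  ∑ (vecs xs (suc n)) (weight (w ∷ ws))
    ≡⟨ ∑-cartesianProductWith _∷_ xs (vecs xs n) (weight (w ∷ ws)) ⟩
  ∑ xs (λ x → ∑ (vecs xs n) (λ v → w x * weight ws v))
    ≡⟨ ∑-cong xs (λ x → ∑-*ˡ (w x) (vecs xs n) (weight ws)) ⟩
  ∑ xs (λ x → w x * ∑ (vecs xs n) (weight ws))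
    ≡⟨ ∑-*ʳ (∑ (vecs xs n) (weight ws)) xs w ⟩
  ∑ xs w * ∑ (vecs xs n) (weight ws)
    ≡⟨ cong (∑ xs w *_) (∑-weight xs ws) ⟩
  ∑ xs w * ∏ (Vec.map (∑ xs) ws) ∎
  where open ℕ.≤-Reasoning

infixl 7 _·_
_·_ : (A → ℕ) → (A → ℕ) → A → ℕ
(g · h) x = g x * h x

weight-· : ∀ {n} (ws hs : Vec (A → ℕ) n) v →
  weight (zipWith _·_ ws hs) v ≡ weight ws v * weight hs v
weight-· [] [] [] = refl
weight-· (w ∷ ws) (h ∷ hs) (x ∷ v) = trans (cong (w x * h x *_) (weight-· ws hs v))
  (ℕ.[m*n]*[o*p]≡[m*o]*[n*p] (w x) (h x) (weight ws v) (weight hs v))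

weight-updateAt : ∀ {n} (ws : Vec (A → ℕ) n) i h v →
  weight (updateAt ws i (_· h)) v ≡ weight ws v * h (lookup v i)
weight-updateAt (w ∷ ws) Fin.zero h (x ∷ v) = swapʳ (w x) (h x) (weight ws v)
  where
  swapʳ : ∀ a b c → a * b * c ≡ a * c * b
  swapʳ = solve-∀
weight-updateAt (w ∷ ws) (Fin.suc i) h (x ∷ v) = trans
  (cong (w x *_) (weight-updateAt ws i h v))
  (sym (ℕ.*-assoc (w x) (weight ws v) (h (lookup v i))))

𝟙 : Bool → ℕ
𝟙 b = if b then 1 else 0

∑-split : ∀ xs (g : A → ℕ) (Q : A → Bool) →
  ∑ xs (g · (𝟙 ∘ Q)) + ∑ xs (g · (𝟙 ∘ not ∘ Q)) ≡ ∑ xs g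
∑-split xs g Q = trans (sym (∑-+ xs (g · (𝟙 ∘ Q)) (g · (𝟙 ∘ not ∘ Q))))
  (∑-cong xs λ x → split (g x) (Q x))
  where
  split : ∀ k b → k * 𝟙 b + k * 𝟙 (not b) ≡ k
  split k true = trans (cong₂ _+_ (ℕ.*-identityʳ k) (ℕ.*-zeroʳ k)) (ℕ.+-identityʳ k)
  split k false = cong₂ _+_ (ℕ.*-zeroʳ k) (ℕ.*-identityʳ k)

g·𝟙≤g : ∀ (g : A → ℕ) Q x → (g · (𝟙 ∘ Q)) x ≤ g x
g·𝟙≤g g Q x = subst (g x * 𝟙 (Q x) ≤_) (ℕ.*-identityʳ (g x)) (ℕ.*-monoʳ-≤ (g x) (𝟙≤1 (Q x)))
  where
  𝟙≤1 : ∀ b → 𝟙 b ≤ 1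
  𝟙≤1 true = s≤s z≤n
  𝟙≤1 false = z≤n

allBits : ∀ m → List (Bits m)
allBits = vecs (false ∷ true ∷ [])

∈-allBits : ∀ {m} (x : Bits m) → x ∈ allBits m
∈-allBits = ∈-vecs λ where
  false → here refl
  true → there (here refl)

inputs : ∀ n m → List (Vec (Bits m) n)
inputs n m = vecs (allBits m) n

-- The point mass at `x`, as a product over the bits so that `∑-weight` gives its total.
δ : ∀ {m} → Bits m → Bits m → ℕ
δ x = weight (Vec.map (λ b c → 𝟙 (does (b Bool.≟ c))) x)

δ-refl : ∀ {m} (x : Bits m) → δ x x ≡ 1
δ-refl [] = refl
δ-refl (false ∷ x) = trans (ℕ.*-identityˡ (δ x x)) (δ-refl x)
δ-refl (true ∷ x) = trans (ℕ.*-identityˡ (δ x x)) (δ-refl x)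

∑-δ : ∀ {m} (x : Bits m) → ∑ (allBits m) (δ x) ≡ 1
∑-δ x = trans (∑-weight _ (Vec.map _ x)) (ones x)
  where
  ones : ∀ {m} (x : Bits m) → ∏ (Vec.map (∑ (false ∷ true ∷ []))
    (Vec.map (λ b c → 𝟙 (does (b Bool.≟ c))) x)) ≡ 1
  ones [] = refl
  ones (false ∷ x) = trans (ℕ.*-identityˡ _) (ones x)
  ones (true ∷ x) = trans (ℕ.*-identityˡ _) (ones x)

-- Written as `𝟙` of a Boolean and of its negation, so that `∑-split` matches the two answers.
reads : ∀ {m} → Fin m → Bool → Bits m → ℕ
reads j true y = 𝟙 (lookup y j)
reads j false y = 𝟙 (not (lookup y j))

reads-own : ∀ {m} j (y : Bits m) → reads j (lookup y j) y ≡ 1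
reads-own j y with lookup y j in eq
... | true rewrite eq = refl
... | false rewrite eq = refl

-- Success weight of a decision tree for f ^⊗ n

Tree : ℕ → ℕ → Set → Set
Tree m n Z = DecisionTree (Fin n × Fin m) (Vec Z n)

bitAt : ∀ {m n} → Vec (Bits m) n → Fin n × Fin m → Bool
bitAt v (i , j) = lookup (lookup v i) j

module _ {m : ℕ} {Z : Set} (f : Bits m → Z) (_≟_ : DecidableEquality Z) where

  hits : Z → Bits m → ℕ
  hits z y = 𝟙 (does (f y ≟ z))

  -- The indicator of a correct output within `q` queries. The explicit budget also cuts off
  -- branches that no input reaches, about whose length `queries` says nothing.
  good : ∀ {n} → ℕ → Tree m n Z → Vec (Bits m) n → ℕ
  good q       (output zs) v = weight (Vec.map hits zs) v
  good zero    (query p t) v = 0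
  good (suc q) (query p t) v = good q (t (bitAt v p)) v

  correct⇒good : ∀ {n} q (t : Tree m n Z) v → run t (bitAt v) ≡ (f ^⊗ n) v →
    queries t (bitAt v) ≤ q → good q t v ≡ 1
  correct⇒good q (output zs) v refl _ = all-hit v
    where
    all-hit : ∀ {n} (v : Vec (Bits m) n) → weight (Vec.map hits (Vec.map f v)) v ≡ 1
    all-hit [] = refl
    all-hit (y ∷ v) with f y ≟ f y
    ... | yes _ = trans (ℕ.*-identityˡ _) (all-hit v)
    ... | no ≢ = ⊥-elim (≢ refl)
  correct⇒good (suc q) (query p t) v correct (s≤s few) =
    correct⇒good q (t (bitAt v p)) v correct few

  module _ (x : Bits m) (s N : ℕ) (μ : Bits m → ℕ)
    (s≤μ : ∀ y → s ≤ μ y) (N≤μx : N ≤ μ x) (s≤N : s ≤ N) where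

    open ℕ.≤-Reasoning

    tot : (Bits m → ℕ) → ℕ
    tot = ∑ (allBits m)

    -- w is the weight function of one coordinate after some of its bits were read.
    -- While the answers agree with x, the deficit r of the potential counts how many
    -- more queries are needed to certify the value at x.
    data Potential (w : Bits m → ℕ) : ℕ → Set where
      settled : Potential w (tot w)
      pending : ∀ {φ} r K → r ≤ s → Hard f _≟_ x r K →
                (∀ y → Agree x K y → w y ≡ μ y) → φ + r ≡ tot w → Potential w φ

    agree-self : ∀ K → Agree x K x
    agree-self K = All.universal (λ _ → refl) K

    -- While the deficit is `suc r`, two inputs consistent with the answers have different values,
    -- so `x` or `y` has a value other than `z`. Its weight is still untouched, hence at least
    -- `s ≥ suc r`, and is lost to the output `z`.
    leaf-bound : ∀ {w φ} → Potential w φ → ∀ z → tot (w · hits z) ≤ φ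
    leaf-bound {w} settled z = ∑-mono (allBits m) (g·𝟙≤g w _)
    leaf-bound {w} {φ} (pending zero _ _ _ _ φ+0≡) z =
      subst (tot (w · hits z) ≤_) (trans (sym φ+0≡) (ℕ.+-identityʳ φ))
        (∑-mono (allBits m) (g·𝟙≤g w _))
    leaf-bound {w} {φ} (pending (suc r) K r<s ((y , y~x , fx≢fy) , _) w≡μ φ+r≡) z =
      ℕ.+-cancelʳ-≤ (suc r) _ φ (begin
        tot (w · hits z) + suc r       ≤⟨ ℕ.+-monoʳ-≤ (tot (w · hits z)) (missed avoiding) ⟩
        tot (w · hits z) + tot misses  ≡⟨ ∑-split (allBits m) w (λ y → does (f y ≟ z)) ⟩
        tot w                          ≡⟨ φ+r≡ ⟨
        φ + suc r                      ∎)
      where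
      misses : Bits m → ℕ
      misses = w · λ y → 𝟙 (not (does (f y ≟ z)))

      avoiding : ∃ λ u → Agree x K u × f u ≢ z
      avoiding with f x ≟ z
      ... | yes fx≡z = y , y~x , λ fy≡z → fx≢fy (trans fx≡z (sym fy≡z))
      ... | no fx≢z = x , agree-self K , fx≢z

      missed : (∃ λ u → Agree x K u × f u ≢ z) → suc r ≤ tot misses
      missed (u , u~x , fu≢z) = begin
        suc r       ≤⟨ r<s ⟩
        s           ≤⟨ s≤μ u ⟩
        μ u         ≡⟨ w≡μ u u~x ⟨
        w u         ≡⟨ counted ⟨
        misses u    ≤⟨ ∑-point misses (∈-allBits u) ⟩
        tot misses  ∎
        where
        counted : misses u ≡ w u
        counted with f u ≟ z
        ... | yes fu≡z = ⊥-elim (fu≢z fu≡z)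
        ... | no _ = ℕ.*-identityʳ (w u)

    Children : (Bits m → ℕ) → ℕ → Fin m → Set
    Children w φ j = ∃₂ λ φ₀ φ₁ →
      Potential (w · reads j false) φ₀ × Potential (w · reads j true) φ₁ ×
      N * (φ₀ + φ₁) ≤ suc N * φ

    tot-reads : ∀ w j → tot (w · reads j false) + tot (w · reads j true) ≡ tot w
    tot-reads w j = trans (ℕ.+-comm (tot (w · reads j false)) _)
      (∑-split (allBits m) w (λ y → lookup y j))

    settled-children : ∀ {w φ} → φ ≡ tot w → ∀ j → Children w φ j
    settled-children {w} {φ} φ≡ j = _ , _ , settled , settled , (begin
      N * (tot (w · reads j false) + tot (w · reads j true))
        ≡⟨ cong (N *_) (trans (tot-reads w j) (sym φ≡)) ⟩
      N * φ
        ≤⟨ ℕ.*-monoˡ-≤ φ (ℕ.n≤1+n N) ⟩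
      suc N * φ ∎)

    -- The answer against `x` settles the coordinate; the answer shared with `x` lowers the deficit
    -- from `suc r` to `r`. The two potentials then sum to `tot w - r`, which is `φ + 1`, and the
    -- excess 1 is at most `φ / N` because `N ≤ φ`.
    children : ∀ {w φ} → Potential w φ → ∀ j → Children w φ j
    children settled j = settled-children refl j
    children {φ = φ} (pending zero _ _ _ _ φ+0≡) j =
      settled-children (trans (sym (ℕ.+-identityʳ φ)) φ+0≡) j
    children {w} {φ} (pending (suc r) K r<s ((y , y~x , fx≢fy) , hard) w≡μ φ+r≡) j =
      cases (lookup x j) refl
      where
      along : Bool → ℕ
      along b = tot (w · reads j b)

      r≤s : r ≤ s
      r≤s = ℕ.<⇒≤ r<s

      N≤wx : N ≤ w x
      N≤wx = subst (N ≤_) (sym (w≡μ x (agree-self K))) N≤μx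

      -- Makes the truncated subtraction in `x-child` exact.
      r≤along : r ≤ along (lookup x j)
      r≤along = begin
        r                              ≤⟨ r≤s ⟩
        s                              ≤⟨ s≤N ⟩
        N                              ≤⟨ N≤wx ⟩
        w x                            ≡⟨ ℕ.*-identityʳ (w x) ⟨
        w x * 1                        ≡⟨ cong (w x *_) (reads-own j x) ⟨
        w x * reads j (lookup x j) x   ≤⟨ ∑-point (w · reads j (lookup x j)) (∈-allBits x) ⟩
        along (lookup x j)             ∎

      x-child : Potential (w · reads j (lookup x j)) (along (lookup x j) ∸ r)
      x-child = pending r (j ∷ K) r≤s (hard j)
        (λ { u (uj≡xj ∷ u~x) → trans
          (cong (w u *_) (trans (cong (λ b → reads j b u) (sym uj≡xj)) (reads-own j u)))
          (trans (ℕ.*-identityʳ (w u)) (w≡μ u u~x)) })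
        (ℕ.m∸n+n≡m r≤along)

      same : Bits m → Bool
      same u = does (f u ≟ f x)

      wx≤ : w x ≤ tot (w · (𝟙 ∘ same))
      wx≤ = ℕ.≤-trans (ℕ.≤-reflexive counted) (∑-point (w · (𝟙 ∘ same)) (∈-allBits x))
        where
        counted : w x ≡ w x * 𝟙 (same x)
        counted with f x ≟ f x
        ... | yes _ = sym (ℕ.*-identityʳ (w x))
        ... | no ≢ = ⊥-elim (≢ refl)

      wy≤ : w y ≤ tot (w · (𝟙 ∘ not ∘ same))
      wy≤ = ℕ.≤-trans (ℕ.≤-reflexive counted) (∑-point (w · (𝟙 ∘ not ∘ same)) (∈-allBits y))
        where
        counted : w y ≡ w y * 𝟙 (not (same y))
        counted with f y ≟ f x
        ... | yes fy≡fx = ⊥-elim (fx≢fy (sym fy≡fx))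
        ... | no _ = sym (ℕ.*-identityʳ (w y))

      -- `x` and `y` have different values, so their weights, at least `N` and `suc r`, lie in
      -- disjoint parts of `tot w` and can be added.
      N≤φ : N ≤ φ
      N≤φ = ℕ.+-cancelʳ-≤ (suc r) N φ (begin
        N + suc r      ≤⟨ ℕ.+-mono-≤ N≤wx (subst (suc r ≤_) (sym (w≡μ y y~x))
                            (ℕ.≤-trans r<s (s≤μ y))) ⟩
        w x + w y      ≤⟨ ℕ.+-mono-≤ wx≤ wy≤ ⟩
        tot (w · (𝟙 ∘ same)) + tot (w · (𝟙 ∘ not ∘ same))
                       ≡⟨ ∑-split (allBits m) w same ⟩
        tot w          ≡⟨ φ+r≡ ⟨
        φ + suc r      ∎)

      gain : ∀ a b → r ≤ a → a + b ≡ tot w → N * (a ∸ r + b) ≤ suc N * φ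
      gain a b r≤a a+b≡ = begin
        N * (a ∸ r + b)  ≡⟨ cong (N *_) (ℕ.+-cancelʳ-≡ r _ _ (trans rearranged (ℕ.+-suc φ r))) ⟩
        N * suc φ        ≡⟨ ℕ.*-suc N φ ⟩
        N + N * φ        ≤⟨ ℕ.+-monoˡ-≤ (N * φ) N≤φ ⟩
        suc N * φ        ∎
        where
        rearranged : a ∸ r + b + r ≡ φ + suc r
        rearranged = begin-equality
          a ∸ r + b + r    ≡⟨ ℕ.+-assoc (a ∸ r) b r ⟩
          a ∸ r + (b + r)  ≡⟨ cong (a ∸ r +_) (ℕ.+-comm b r) ⟩
          a ∸ r + (r + b)  ≡⟨ ℕ.+-assoc (a ∸ r) r b ⟨
          a ∸ r + r + b    ≡⟨ cong (_+ b) (ℕ.m∸n+n≡m r≤a) ⟩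
          a + b            ≡⟨ trans a+b≡ (sym φ+r≡) ⟩
          φ + suc r        ∎

      cases : ∀ b → lookup x j ≡ b → Children w φ j
      cases false xj≡ = along false ∸ r , along true
        , subst (λ b → Potential (w · reads j b) (along b ∸ r)) xj≡ x-child , settled
        , gain _ _ (subst (λ b → r ≤ along b) xj≡ r≤along) (tot-reads w j)
      cases true xj≡ = along false , along true ∸ r
        , settled , subst (λ b → Potential (w · reads j b) (along b ∸ r)) xj≡ x-child
        , subst (λ k → N * k ≤ suc N * φ) (ℕ.+-comm (along true ∸ r) (along false))
            (gain _ _ (subst (λ b → r ≤ along b) xj≡ r≤along)
              (trans (ℕ.+-comm (along true) (along false)) (tot-reads w j)))

    read : ∀ {n} → Vec (Bits m → ℕ) n → Fin n × Fin m → Bool → Vec (Bits m → ℕ) n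
    read ws (i , j) b = updateAt ws i (_· reads j b)

    Potentials : ∀ {n} → Vec (Bits m → ℕ) n → Vec ℕ n → Set
    Potentials = Pointwise Potential

    product-children : ∀ {n} {ws : Vec (Bits m → ℕ) n} {φs} → Potentials ws φs → ∀ p →
      ∃₂ λ φs₀ φs₁ → Potentials (read ws p false) φs₀ ×
        Potentials (read ws p true) φs₁ × N * (∏ φs₀ + ∏ φs₁) ≤ suc N * ∏ φs
    product-children {φs = φ ∷ φs} (pot ∷ pots) (Fin.zero , j) =
      let φ₀ , φ₁ , pot₀ , pot₁ , gain = children pot j
      in φ₀ ∷ φs , φ₁ ∷ φs , pot₀ ∷ pots , pot₁ ∷ pots , (begin
        N * (φ₀ * ∏ φs + φ₁ * ∏ φs)  ≡⟨ cong (N *_) (ℕ.*-distribʳ-+ (∏ φs) φ₀ φ₁) ⟨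
        N * ((φ₀ + φ₁) * ∏ φs)       ≡⟨ ℕ.*-assoc N (φ₀ + φ₁) (∏ φs) ⟨
        N * (φ₀ + φ₁) * ∏ φs         ≤⟨ ℕ.*-monoˡ-≤ (∏ φs) gain ⟩
        suc N * φ * ∏ φs             ≡⟨ ℕ.*-assoc (suc N) φ (∏ φs) ⟩
        suc N * (φ * ∏ φs)           ∎)
    product-children {φs = φ ∷ φs} (pot ∷ pots) (Fin.suc i , j) =
      let φs₀ , φs₁ , pots₀ , pots₁ , gain = product-children pots (i , j)
      in φ ∷ φs₀ , φ ∷ φs₁ , pot ∷ pots₀ , pot ∷ pots₁ , (begin
        N * (φ * ∏ φs₀ + φ * ∏ φs₁)  ≡⟨ factor N φ (∏ φs₀) (∏ φs₁) ⟩
        φ * (N * (∏ φs₀ + ∏ φs₁))    ≤⟨ ℕ.*-monoʳ-≤ φ gain ⟩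
        φ * (suc N * ∏ φs)           ≡⟨ interchange φ (suc N) (∏ φs) ⟩
        suc N * (φ * ∏ φs)           ∎)
      where
      factor : ∀ N φ a b → N * (φ * a + φ * b) ≡ φ * (N * (a + b))
      factor = solve-∀
      interchange : ∀ a b c → a * (b * c) ≡ b * (a * c)
      interchange = solve-∀

    success : ∀ {n} → Vec (Bits m → ℕ) n → ℕ → Tree m n Z → ℕ
    success {n} ws q t = ∑ (inputs n m) (weight ws · good q t)

    -- For a fixed output, correctness is a product over the coordinates, so the success weight
    -- factors and `leaf-bound` applies to each factor.
    success-output : ∀ {n} {ws : Vec (Bits m → ℕ) n} {φs} → Potentials ws φs →
      ∀ q zs → success ws q (output zs) ≤ ∏ φs
    success-output {n} {ws} {φs} pots q zs = begin
      ∑ (inputs n m) (weight ws · weight (Vec.map hits zs))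
        ≡⟨ ∑-cong (inputs n m) (weight-· ws (Vec.map hits zs)) ⟨
      ∑ (inputs n m) (weight (zipWith _·_ ws (Vec.map hits zs)))
        ≡⟨ ∑-weight (allBits m) (zipWith _·_ ws (Vec.map hits zs)) ⟩
      ∏ (Vec.map tot (zipWith _·_ ws (Vec.map hits zs)))
        ≤⟨ bound pots zs ⟩
      ∏ φs ∎
      where
      bound : ∀ {n} {ws : Vec (Bits m → ℕ) n} {φs} → Potentials ws φs →
        ∀ zs → ∏ (Vec.map tot (zipWith _·_ ws (Vec.map hits zs))) ≤ ∏ φs
      bound [] [] = ℕ.≤-refl
      bound (pot ∷ pots) (z ∷ zs) = ℕ.*-mono-≤ (leaf-bound pot z) (bound pots zs)

    -- Conditioning on the answer changes the density of the queried coordinate only, so both parts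
    -- are again product measures.
    success-query : ∀ {n} (ws : Vec (Bits m → ℕ) n) q p t → success ws (suc q) (query p t) ≡
      success (read ws p false) q (t false) + success (read ws p true) q (t true)
    success-query {n} ws q p@(i , j) t = trans
      (∑-cong (inputs n m) λ v → trans (split v (bitAt v p) refl) (sym (cong₂ _+_
        (cong (_* good q (t false) v) (weight-updateAt ws i (reads j false) v))
        (cong (_* good q (t true) v) (weight-updateAt ws i (reads j true) v)))))
      (∑-+ (inputs n m) _ _)
      where
      split : ∀ v b → bitAt v p ≡ b → weight ws v * good q (t (bitAt v p)) v ≡
        weight ws v * reads j false (lookup v i) * good q (t false) v +
        weight ws v * reads j true (lookup v i) * good q (t true) v
      split v false eq rewrite eq = left (weight ws v) _ _
        where
        left : ∀ a b c → a * b ≡ a * 1 * b + a * 0 * c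
        left = solve-∀
      split v true eq rewrite eq = right (weight ws v) _ _
        where
        right : ∀ a b c → a * c ≡ a * 0 * b + a * 1 * c
        right = solve-∀

    -- Induction along the tree: each query costs at most a factor `1 + 1/N`. A leaf reached with
    -- budget to spare is covered by `N ≤ suc N`, and a query without budget has success weight 0.
    success-bound : ∀ {n} {ws : Vec (Bits m → ℕ) n} {φs} → Potentials ws φs →
      ∀ q t → N ^ q * success ws q t ≤ suc N ^ q * ∏ φs
    success-bound pots q (output zs) =
      ℕ.*-mono-≤ (ℕ.^-monoˡ-≤ q (ℕ.n≤1+n N)) (success-output pots q zs)
    success-bound {n} {ws} {φs} pots zero (query p t) = begin
      1 * success ws 0 (query p t)
        ≡⟨ cong (1 *_) (∑-zero (inputs n m) (λ v → ℕ.*-zeroʳ (weight ws v))) ⟩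
      0
        ≤⟨ z≤n ⟩
      1 * ∏ φs ∎
    success-bound {ws = ws} {φs} pots (suc q) (query p t) =
      let φs₀ , φs₁ , pots₀ , pots₁ , gain = product-children pots p
          s₀ = success (read ws p false) q (t false)
          s₁ = success (read ws p true) q (t true)
      in begin
        N ^ suc q * success ws (suc q) (query p t)
          ≡⟨ cong (N ^ suc q *_) (success-query ws q p t) ⟩
        N * N ^ q * (s₀ + s₁)
          ≡⟨ expand N (N ^ q) s₀ s₁ ⟩
        N * (N ^ q * s₀ + N ^ q * s₁)
          ≤⟨ ℕ.*-monoʳ-≤ N (ℕ.+-mono-≤ (success-bound pots₀ q (t false))
               (success-bound pots₁ q (t true))) ⟩
        N * (suc N ^ q * ∏ φs₀ + suc N ^ q * ∏ φs₁)
          ≡⟨ regroup N (suc N ^ q) (∏ φs₀) (∏ φs₁) ⟩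
        suc N ^ q * (N * (∏ φs₀ + ∏ φs₁))
          ≤⟨ ℕ.*-monoʳ-≤ (suc N ^ q) gain ⟩
        suc N ^ q * (suc N * ∏ φs)
          ≡⟨ commute (suc N ^ q) (suc N) (∏ φs) ⟩
        suc N ^ suc q * ∏ φs ∎
      where
      expand : ∀ N k a b → N * k * (a + b) ≡ N * (k * a + k * b)
      expand = solve-∀
      regroup : ∀ N k a b → N * (k * a + k * b) ≡ k * (N * (a + b))
      regroup = solve-∀
      commute : ∀ k S p → k * (S * p) ≡ S * k * p
      commute = solve-∀

-- Numerical estimates for the decay of the success probability

-- (1 - 1/(a+1))^s ≥ 1 - s/(a+1) with denominators cleared.
bernoulli-lower : ∀ a s φ → φ + s ≡ suc a → φ * suc a ^ s ≤ a ^ s * suc a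
bernoulli-lower a zero φ φ+0≡ = ℕ.≤-reflexive (trans (ℕ.*-identityʳ φ)
  (trans (trans (sym (ℕ.+-identityʳ φ)) φ+0≡) (sym (ℕ.*-identityˡ (suc a)))))
bernoulli-lower a (suc s) φ φ+s≡ = begin
  φ * (suc a * suc a ^ s)      ≡⟨ ℕ.*-assoc φ (suc a) (suc a ^ s) ⟨
  φ * suc a * suc a ^ s        ≤⟨ ℕ.*-monoˡ-≤ (suc a ^ s) shrink ⟩
  a * suc φ * suc a ^ s        ≡⟨ ℕ.*-assoc a (suc φ) (suc a ^ s) ⟩
  a * (suc φ * suc a ^ s)      ≤⟨ ℕ.*-monoʳ-≤ a (bernoulli-lower a s (suc φ)
                                    (trans (sym (ℕ.+-suc φ s)) φ+s≡)) ⟩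
  a * (a ^ s * suc a)          ≡⟨ ℕ.*-assoc a (a ^ s) (suc a) ⟨
  a ^ suc s * suc a            ∎
  where
  open ℕ.≤-Reasoning
  φ≤a : φ ≤ a
  φ≤a = ℕ.≤-pred (subst (suc φ ≤_) (trans (sym (ℕ.+-suc φ s)) φ+s≡) (ℕ.m≤m+n (suc φ) s))

  shrink : φ * suc a ≤ a * suc φ
  shrink = begin
    φ * suc a      ≡⟨ ℕ.*-suc φ a ⟩
    φ + φ * a      ≤⟨ ℕ.+-monoˡ-≤ (φ * a) φ≤a ⟩
    a + φ * a      ≡⟨ cong (a +_) (ℕ.*-comm φ a) ⟩
    a + a * φ      ≡⟨ ℕ.*-suc a φ ⟨
    a * suc φ      ∎

-- Makes the decay explicit: `(a/(a+1))^e` is at most `a/(a+e)`, by Bernoulli's inequality for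
-- `1 + 1/a`.
bernoulli-upper : ∀ a e → a ^ e * (a + e) ≤ a * suc a ^ e
bernoulli-upper a zero = ℕ.≤-reflexive (base a)
  where
  base : ∀ a → 1 * (a + 0) ≡ a * 1
  base = solve-∀
bernoulli-upper a (suc e) = begin
  a * a ^ e * (a + suc e)            ≡⟨ expand a (a ^ e) e ⟩
  a * (a ^ e * (a + e)) + a * a ^ e  ≤⟨ ℕ.+-mono-≤ (ℕ.*-monoʳ-≤ a (bernoulli-upper a e))
                                          (ℕ.*-monoʳ-≤ a (ℕ.^-monoˡ-≤ e (ℕ.n≤1+n a))) ⟩
  a * (a * suc a ^ e) + a * suc a ^ e ≡⟨ collect a (suc a ^ e) ⟩
  a * (suc a * suc a ^ e)            ∎
  where
  open ℕ.≤-Reasoning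
  expand : ∀ a k e → a * k * (a + suc e) ≡ a * (k * (a + e)) + a * k
  expand = solve-∀
  collect : ∀ a k → a * (a * k) + a * k ≡ a * (suc a * k)
  collect = solve-∀

^-distribʳ-* : ∀ m n k → (m * n) ^ k ≡ m ^ k * n ^ k
^-distribʳ-* m n zero = refl
^-distribʳ-* m n (suc k) = trans (cong (m * n *_) (^-distribʳ-* m n k))
  (ℕ.[m*n]*[o*p]≡[m*o]*[n*p] m n (m ^ k) (n ^ k))

-- A query gains a factor 1 + 1/N; two of the s n factors a/(a+1) compensate for it.
query-compensated : ∀ N a → suc a ≤ N + N → suc N * (a * a) ≤ N * (suc a * suc a)
query-compensated N a a<2N = begin
  a * a + N * (a * a)              ≤⟨ ℕ.+-monoˡ-≤ (N * (a * a))
                                        (ℕ.*-monoˡ-≤ a (ℕ.<⇒≤ a<2N)) ⟩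
  (N + N) * a + N * (a * a)        ≤⟨ ℕ.m≤m+n _ N ⟩
  (N + N) * a + N * (a * a) + N    ≡⟨ square N a ⟩
  N * (suc a * suc a)              ∎
  where
  open ℕ.≤-Reasoning
  square : ∀ N a → (N + N) * a + N * (a * a) + N ≡ N * (suc a * suc a)
  square = solve-∀

-- Here `F / (a+1)^n` is a success probability, at most `(1 + 1/N)^q (φ/(a+1))^n`. By
-- `bernoulli-lower` each coordinate contributes `s` factors `a/(a+1)`; of the `s n` in total, `2q`
-- cancel the growth from the queries, and the remaining `e` leave at most `a/(a+e)`.
decay : ∀ N a φ s n q e F → .{{NonZero N}} → .{{NonZero a}} → suc a ≤ N + N →
  φ + s ≡ suc a → s * n ≡ (q + q) + e → N ^ q * F ≤ suc N ^ q * φ ^ n →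
  F * (a + e) ≤ a * suc a ^ n
decay N a φ s n q e F a<2N φ+s≡ sn≡ bound = ℕ.*-cancelʳ-≤ _ _ (a ^ e) {{ℕ.m^n≢0 a e}} (begin
  F * (a + e) * a ^ e      ≡⟨ rotate F (a + e) (a ^ e) ⟩
  F * (a ^ e * (a + e))    ≤⟨ ℕ.*-monoʳ-≤ F (bernoulli-upper a e) ⟩
  F * (a * b ^ e)          ≡⟨ rotate′ F a (b ^ e) ⟩
  a * (F * b ^ e)          ≤⟨ ℕ.*-monoʳ-≤ a geometric ⟩
  a * (a ^ e * b ^ n)      ≡⟨ rotate″ a (a ^ e) (b ^ n) ⟩
  a * b ^ n * a ^ e        ∎)
  where
  open ℕ.≤-Reasoning
  b : ℕ
  b = suc a

  rotate : ∀ x y z → x * y * z ≡ x * (z * y)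
  rotate = solve-∀
  rotate′ : ∀ x y z → x * (y * z) ≡ y * (x * z)
  rotate′ = solve-∀
  rotate″ : ∀ x y z → x * (y * z) ≡ x * z * y
  rotate″ = solve-∀

  ^-sn : ∀ c → c ^ (s * n) ≡ (c * c) ^ q * c ^ e
  ^-sn c = begin-equality
    c ^ (s * n)              ≡⟨ cong (c ^_) sn≡ ⟩
    c ^ ((q + q) + e)        ≡⟨ ℕ.^-distribˡ-+-* c (q + q) e ⟩
    c ^ (q + q) * c ^ e      ≡⟨ cong (_* c ^ e) (ℕ.^-distribˡ-+-* c q q) ⟩
    c ^ q * c ^ q * c ^ e    ≡⟨ cong (_* c ^ e) (^-distribʳ-* c c q) ⟨
    (c * c) ^ q * c ^ e      ∎

  compensated : suc N ^ q * (a * a) ^ q ≤ N ^ q * (b * b) ^ q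
  compensated = subst₂ _≤_ (^-distribʳ-* (suc N) (a * a) q) (^-distribʳ-* N (b * b) q)
    (ℕ.^-monoˡ-≤ q (query-compensated N a a<2N))

  coordinates : φ ^ n * b ^ (s * n) ≤ a ^ (s * n) * b ^ n
  coordinates = begin
    φ ^ n * b ^ (s * n)    ≡⟨ cong (φ ^ n *_) (ℕ.^-*-assoc b s n) ⟨
    φ ^ n * (b ^ s) ^ n    ≡⟨ ^-distribʳ-* φ (b ^ s) n ⟨
    (φ * b ^ s) ^ n        ≤⟨ ℕ.^-monoˡ-≤ n (bernoulli-lower a s φ φ+s≡) ⟩
    (a ^ s * b) ^ n        ≡⟨ ^-distribʳ-* (a ^ s) b n ⟩
    (a ^ s) ^ n * b ^ n    ≡⟨ cong (_* b ^ n) (ℕ.^-*-assoc a s n) ⟩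
    a ^ (s * n) * b ^ n    ∎

  α β k : ℕ
  α = (a * a) ^ q
  β = (b * b) ^ q
  k = N ^ q * α * β

  geometric : F * b ^ e ≤ a ^ e * b ^ n
  geometric = ℕ.*-cancelˡ-≤ k {{k≢0}} (begin
    N ^ q * α * β * (F * b ^ e)
      ≡⟨ arrange₁ (N ^ q) α β F (b ^ e) ⟩
    N ^ q * F * (α * (β * b ^ e))
      ≤⟨ ℕ.*-monoˡ-≤ (α * (β * b ^ e)) bound ⟩
    suc N ^ q * φ ^ n * (α * (β * b ^ e))
      ≡⟨ cong (λ z → suc N ^ q * φ ^ n * (α * z)) (^-sn b) ⟨
    suc N ^ q * φ ^ n * (α * b ^ (s * n))
      ≡⟨ ℕ.[m*n]*[o*p]≡[m*o]*[n*p] (suc N ^ q) (φ ^ n) α (b ^ (s * n)) ⟩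
    suc N ^ q * α * (φ ^ n * b ^ (s * n))
      ≤⟨ ℕ.*-mono-≤ compensated coordinates ⟩
    N ^ q * β * (a ^ (s * n) * b ^ n)
      ≡⟨ cong (λ z → N ^ q * β * (z * b ^ n)) (^-sn a) ⟩
    N ^ q * β * (α * a ^ e * b ^ n)
      ≡⟨ arrange₂ (N ^ q) α β (a ^ e) (b ^ n) ⟩
    N ^ q * α * β * (a ^ e * b ^ n) ∎)
    where
    arrange₁ : ∀ n a b f c → n * a * b * (f * c) ≡ n * f * (a * (b * c))
    arrange₁ = solve-∀
    arrange₂ : ∀ n a b c d → n * b * (a * c * d) ≡ n * a * b * (c * d)
    arrange₂ = solve-∀

    k≢0 : NonZero k
    k≢0 = ℕ.m*n≢0 (N ^ q * α) β
      {{ℕ.m*n≢0 (N ^ q) α {{ℕ.m^n≢0 N q}} {{ℕ.m^n≢0 (a * a) q {{ℕ.m*n≢0 a a}}}}}}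
      {{ℕ.m^n≢0 (b * b) q}}

-- The hard product distribution

∏-map-replicate : ∀ (g : A → ℕ) w n → ∏ (Vec.map g (replicate n w)) ≡ g w ^ n
∏-map-replicate g w zero = refl
∏-map-replicate g w (suc n) = cong (g w *_) (∏-map-replicate g w n)

∏-replicate : ∀ k n → ∏ (replicate n k) ≡ k ^ n
∏-replicate k zero = refl
∏-replicate k (suc n) = cong (k *_) (∏-replicate k n)

module _ {m : ℕ} {Z : Set} (f : Bits m → Z) (_≟_ : DecidableEquality Z) where

  open ℕ.≤-Reasoning

  -- The obstruction for Yao's principle, with an unnormalised distribution `W` to stay within ℕ: no
  -- tree succeeds with probability above `c / n`. What counts is that `c` can be chosen
  -- independently of `n`.
  Unreliable : ∀ n → ℕ → ℕ → Set
  Unreliable n q c = ∃ λ (W : Vec (Bits m) n → ℕ) → 0 < ∑ (inputs n m) W ×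
    (∀ t → ∑ (inputs n m) (W · good f _≟_ q t) * n ≤ c * ∑ (inputs n m) W)

  -- The hard distribution is the n-fold product of the one that puts weight N + s on
  -- the hard input x and weight s on all other inputs, where N = s 2ᵐ.
  hard⇒unreliable : ∀ x s → 0 < s → Hard f _≟_ x s [] →
    ∃ λ c → ∀ n q → 4 * q ≤ s * n → Unreliable n q c
  hard⇒unreliable x s 0<s hard = a + a , unreliable
    where
    N : ℕ
    N = ∑ (allBits m) (λ _ → s)

    μ : Bits m → ℕ
    μ y = s + N * δ x y

    -- `μ` has total weight `2N = a + 1`, and `φ` is the initial potential of a coordinate, the
    -- total less the full deficit `s`.
    a φ : ℕ
    a = pred (N + N)
    φ = N + N ∸ s

    s≤N : s ≤ N
    s≤N = ∑-point (λ _ → s) (∈-allBits x)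

    0<N : 0 < N
    0<N = ℕ.<-≤-trans 0<s s≤N

    instance
      N≢0 : NonZero N
      N≢0 = >-nonZero 0<N

      2N≢0 : NonZero (N + N)
      2N≢0 = >-nonZero (ℕ.<-≤-trans 0<N (ℕ.m≤m+n N N))

      a≢0 : NonZero a
      a≢0 = >-nonZero (ℕ.≤-pred (subst (2 ≤_) (sym (ℕ.suc-pred (N + N)))
        (ℕ.+-mono-≤ 0<N 0<N)))

    1+a≡2N : suc a ≡ N + N
    1+a≡2N = ℕ.suc-pred (N + N)

    μ-total : ∑ (allBits m) μ ≡ suc a
    μ-total = begin-equality
      ∑ (allBits m) μ                        ≡⟨ ∑-+ (allBits m) (λ _ → s) (λ y → N * δ x y) ⟩
      N + ∑ (allBits m) (λ y → N * δ x y)    ≡⟨ cong (N +_) (∑-*ˡ N (allBits m) (δ x)) ⟩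
      N + N * ∑ (allBits m) (δ x)            ≡⟨ cong (λ k → N + N * k) (∑-δ x) ⟩
      N + N * 1                              ≡⟨ cong (N +_) (ℕ.*-identityʳ N) ⟩
      N + N                                  ≡⟨ 1+a≡2N ⟨
      suc a                                  ∎

    φ+s≡ : φ + s ≡ suc a
    φ+s≡ = trans (ℕ.m∸n+n≡m (ℕ.≤-trans s≤N (ℕ.m≤m+n N N))) (sym 1+a≡2N)

    s≤μ : ∀ y → s ≤ μ y
    s≤μ y = ℕ.m≤m+n s (N * δ x y)

    N≤μx : N ≤ μ x
    N≤μx = begin
      N            ≡⟨ ℕ.*-identityʳ N ⟨
      N * 1        ≡⟨ cong (N *_) (δ-refl x) ⟨
      N * δ x x    ≤⟨ ℕ.m≤n+m (N * δ x x) s ⟩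
      μ x          ∎

    initial : ∀ n → Potentials f _≟_ x s N μ s≤μ N≤μx s≤N (replicate n μ) (replicate n φ)
    initial zero = []
    initial (suc n) = pending s [] ℕ.≤-refl hard (λ _ _ → refl) (trans φ+s≡ (sym μ-total))
      ∷ initial n

    unreliable : ∀ n q → 4 * q ≤ s * n → Unreliable n q (a + a)
    unreliable n q 4q≤sn = W , subst (0 <_) (sym W-total) (ℕ.m^n>0 (suc a) n) , λ t → begin
      F t * n                          ≤⟨ ℕ.*-monoʳ-≤ (F t) n≤2e ⟩
      F t * (e + e)                    ≤⟨ ℕ.*-monoʳ-≤ (F t)
                                            (ℕ.+-mono-≤ (ℕ.m≤n+m e a) (ℕ.m≤n+m e a)) ⟩
      F t * ((a + e) + (a + e))        ≡⟨ ℕ.*-distribˡ-+ (F t) (a + e) (a + e) ⟩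
      F t * (a + e) + F t * (a + e)    ≤⟨ ℕ.+-mono-≤ (few t) (few t) ⟩
      a * suc a ^ n + a * suc a ^ n    ≡⟨ ℕ.*-distribʳ-+ (suc a ^ n) a a ⟨
      (a + a) * suc a ^ n              ≡⟨ cong ((a + a) *_) W-total ⟨
      (a + a) * ∑ (inputs n m) W       ∎
      where
      W : Vec (Bits m) n → ℕ
      W = weight (replicate n μ)

      F : Tree m n Z → ℕ
      F t = ∑ (inputs n m) (W · good f _≟_ q t)

      W-total : ∑ (inputs n m) W ≡ suc a ^ n
      W-total = begin-equality
        ∑ (inputs n m) W                           ≡⟨ ∑-weight (allBits m) (replicate n μ) ⟩
        ∏ (Vec.map (∑ (allBits m)) (replicate n μ)) ≡⟨ ∏-map-replicate (∑ (allBits m)) μ n ⟩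
        ∑ (allBits m) μ ^ n                        ≡⟨ cong (_^ n) μ-total ⟩
        suc a ^ n                                  ∎

      e : ℕ
      e = s * n ∸ (q + q)

      2q≤sn : q + q ≤ s * n
      2q≤sn = ℕ.≤-trans (ℕ.+-monoʳ-≤ q (ℕ.m≤m+n q (q + (q + 0)))) 4q≤sn

      sn≡ : s * n ≡ q + q + e
      sn≡ = sym (ℕ.m+[n∸m]≡n 2q≤sn)

      -- As `4 q ≤ s n`, compensation uses up at most half of the `s n` factors. So the bound
      -- `a/(a+e)` is at most `2a/n`, whence the constant `a + a`.
      n≤2e : n ≤ e + e
      n≤2e = ℕ.≤-trans (ℕ.m≤n*m n s {{>-nonZero 0<s}})
        (ℕ.+-cancelˡ-≤ (s * n) (s * n) (e + e) (begin
          s * n + s * n                  ≡⟨ cong₂ _+_ sn≡ sn≡ ⟩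
          q + q + e + (q + q + e)        ≡⟨ regroup q e ⟩
          4 * q + (e + e)                ≤⟨ ℕ.+-monoˡ-≤ (e + e) 4q≤sn ⟩
          s * n + (e + e)                ∎))
        where
        regroup : ∀ q e → q + q + e + (q + q + e) ≡ 4 * q + (e + e)
        regroup = solve-∀

      few : ∀ t → F t * (a + e) ≤ a * suc a ^ n
      few t = decay N a φ s n q e (F t) (ℕ.≤-reflexive 1+a≡2N) φ+s≡ sn≡
        (subst (λ k → N ^ q * F t ≤ suc N ^ q * k) (∏-replicate φ n)
          (success-bound f _≟_ x s N μ s≤μ N≤μx s≤N (initial n) q t))

-- Averaging over the trees of a randomized algorithm

open import Data.Integer.Base using (+_)

-- Repeated addition of 1 rather than a fraction `n / 1`: general semiring facts then give
-- compatibility with sums and products without normalising fractions.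
ι : ℕ → ℚ
ι n = n ×ℚ 1ℚ

ι-+ : ∀ m n → ι (m + n) ≡ ι m ℚ.+ ι n
ι-+ = ×-homo-+ 1ℚ

ι-* : ∀ m n → ι (m * n) ≡ ι m ℚ.* ι n
ι-* = ×1-homo-*

0≤ι : ∀ n → 0ℚ ℚ.≤ ι n
0≤ι zero = ℚ.≤-refl
0≤ι (suc n) = ℚ.+-mono-≤ (ℚ.nonNegative⁻¹ 1ℚ) (0≤ι n)

ι-positive : ∀ n → ℚ.Positive (ι (suc n))
ι-positive n = ℚ.positive (ℚ.+-mono-<-≤ (ℚ.positive⁻¹ 1ℚ) (0≤ι n))

ι*-monoʳ-≤ : ∀ n {p q} → p ℚ.≤ q → ι n ℚ.* p ℚ.≤ ι n ℚ.* q
ι*-monoʳ-≤ n = ℚ.*-monoˡ-≤-nonNeg (ι n) {{ℚ.nonNegative (0≤ι n)}}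

ι*-monoˡ-≤ : ∀ n {p q} → p ℚ.≤ q → p ℚ.* ι n ℚ.≤ q ℚ.* ι n
ι*-monoˡ-≤ n = ℚ.*-monoʳ-≤-nonNeg (ι n) {{ℚ.nonNegative (0≤ι n)}}

ι-mono : ∀ {m n} → m ≤ n → ι m ℚ.≤ ι n
ι-mono {n = n} z≤n = 0≤ι n
ι-mono (s≤s m≤n) = ℚ.+-monoʳ-≤ 1ℚ (ι-mono m≤n)

ι-cancel-≤ : ∀ {m n} → ι m ℚ.≤ ι n → m ≤ n
ι-cancel-≤ {m} {n} ιm≤ιn with m ℕ.≤? n
... | yes m≤n = m≤n
... | no m≰n = contradiction (ℚ.<-≤-trans (ℚ.<-≤-trans ιn<ι1+n (ι-mono (ℕ.≰⇒> m≰n))) ιm≤ιn)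
  (ℚ.<-irrefl refl)
  where
  ιn<ι1+n : ι n ℚ.< ι (suc n)
  ιn<ι1+n = subst (ℚ._< ι (suc n)) (ℚ.+-identityˡ (ι n))
    (ℚ.+-monoˡ-< (ι n) (ℚ.positive⁻¹ 1ℚ))

toℚᵘ-ι : ∀ n → ℚ.toℚᵘ (ι n) ℚᵘ.≃ ℚᵘ.mkℚᵘ (+ n) 0
toℚᵘ-ι zero = ℚᵘ.≃-refl
toℚᵘ-ι (suc n) = ℚᵘ.≃-trans (ℚ.toℚᵘ-homo-+ 1ℚ (ι n))
  (ℚᵘ.≃-trans (ℚᵘ.+-congʳ ℚᵘ.1ℚᵘ (toℚᵘ-ι n)) (ℚᵘ.*≡* (one-plus (+ n))))
  where
  one-plus : ∀ i → (ℤ.1ℤ ℤ.* ℤ.1ℤ ℤ.+ i ℤ.* ℤ.1ℤ) ℤ.* ℤ.1ℤ ≡ (ℤ.1ℤ ℤ.+ i) ℤ.* (ℤ.1ℤ ℤ.* ℤ.1ℤ)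
  one-plus = ℤ-Solver.solve-∀

archimedean : ∀ δ → 0ℚ ℚ.< δ → ∃ λ D → 1ℚ ℚ.≤ ι D ℚ.* δ
archimedean (mkℚ (+ zero) _ _) (ℚ.*<* (ℤ.+<+ ()))
archimedean (mkℚ ℤ.-[1+ _ ] _ _) (ℚ.*<* ())
-- The numerator is at least 1, so the denominator `suc e` is a witness.
archimedean δ@(mkℚ (+ suc p) e _) _ = suc e , ℚ.toℚᵘ-cancel-≤
  (ℚᵘ.≤-respʳ-≃ (ℚᵘ.≃-sym (ℚᵘ.≃-trans (ℚ.toℚᵘ-homo-* (ι (suc e)) δ)
      (ℚᵘ.*-congʳ (toℚᵘ-ι (suc e)))))
    (ℚᵘ.*≤* (ℤ.+≤+ (subst₂ _≤_ (left e) (right e p) (ℕ.m≤m*n (suc e) (suc p))))))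
  where
  left : ∀ e → suc e ≡ suc (e + 0 + 0)
  left e = cong suc (sym (trans (ℕ.+-identityʳ (e + 0)) (ℕ.+-identityʳ e)))
  right : ∀ e p → suc e * suc p ≡ suc e * suc p * 1
  right e p = sym (ℕ.*-identityʳ (suc e * suc p))

both : ∀ {P Q : ℕ → Set} → Eventually P → Eventually Q → Eventually λ k → P k × Q k
both (M , p) (N , q) = M ⊔ N , λ k k≥ →
  p k (ℕ.m⊔n≤o⇒m≤o M N k≥) , q k (ℕ.m⊔n≤o⇒n≤o M N k≥)

always : ∀ {P Q : ℕ → Set} → (∀ k → P k → Q k) → Eventually P → Eventually Q
always P⇒Q (N , p) = N , λ k k≥ → P⇒Q k (p k k≥)

-- The approximations of a nonnegative real may be negative; a shift by η repairs this.
shifted : ℚ → ℕ → ℝ → ℚ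
shifted η k p = approx p k ℚ.+ η

module _ {T : Set} where

  -- The expectation of `g`, with `q` replacing each real probability by a rational; it is used with
  -- `shifted η k`, one stage of approximation at a time.
  weighted : (ℝ → ℚ) → List (ℝ × T) → (T → ℕ) → ℚ
  weighted q os g = List.foldr (λ (p , t) → q p ℚ.* ι (g t) ℚ.+_) 0ℚ os

  weighted-+ : ∀ q os g h →
    weighted q os (λ t → g t + h t) ≡ weighted q os g ℚ.+ weighted q os h
  weighted-+ q [] g h = refl
  weighted-+ q ((p , t) ∷ os) g h = trans
    (cong₂ (λ a b → q p ℚ.* a ℚ.+ b) (ι-+ (g t) (h t)) (weighted-+ q os g h))
    (solve 5 (λ c a b d e → c :* (a :+ b) :+ (d :+ e) := (c :* a :+ d) :+ (c :* b :+ e)) refl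
      (q p) (ι (g t)) (ι (h t)) (weighted q os g) (weighted q os h))
    where open +-*-Solver

  weighted-* : ∀ q os c g → weighted q os (λ t → c * g t) ≡ ι c ℚ.* weighted q os g
  weighted-* q [] c g = sym (ℚ.*-zeroʳ (ι c))
  weighted-* q ((p , t) ∷ os) c g = trans
    (cong₂ (λ a b → q p ℚ.* a ℚ.+ b) (ι-* c (g t)) (weighted-* q os c g))
    (solve 4 (λ w c a b → w :* (c :* a) :+ c :* b := c :* (w :* a :+ b)) refl
      (q p) (ι c) (ι (g t)) (weighted q os g))
    where open +-*-Solver

  weighted-mono : ∀ q os {g h} → All (λ (p , _) → 0ℚ ℚ.≤ q p) os → (∀ t → g t ≤ h t) →
    weighted q os g ℚ.≤ weighted q os h
  weighted-mono q [] [] g≤h = ℚ.≤-refl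
  weighted-mono q ((p , t) ∷ os) (0≤q ∷ 0≤qs) g≤h = ℚ.+-mono-≤
    (ℚ.*-monoˡ-≤-nonNeg (q p) {{ℚ.nonNegative 0≤q}} (ι-mono (g≤h t)))
    (weighted-mono q os 0≤qs g≤h)

  -- The easy half of Yao's principle: a guarantee on every input survives averaging over `W`, and
  -- the averages over inputs and over trees are interchanged. As the inputs are finitely many, one
  -- stage of approximation serves them all.
  average : ∀ {X : Set} (q : ℕ → ℝ → ℚ) os θ (W : X → ℕ) (g : T → X → ℕ) →
    (∀ x → Eventually λ k → θ ℚ.≤ weighted (q k) os (λ t → g t x)) → ∀ xs →
    Eventually λ k → θ ℚ.* ι (∑ xs W) ℚ.≤ weighted (q k) os (λ t → ∑ xs (W · g t))
  average q os θ W g θ≤ [] = 0 , λ k _ → ℚ.≤-reflexive (trans (ℚ.*-zeroʳ θ)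
    (sym (trans (weighted-* (q k) os 0 (λ _ → 0)) (ℚ.*-zeroˡ (weighted (q k) os (λ _ → 0))))))
  average q os θ W g θ≤ (x ∷ xs) = always step (both (θ≤ x) (average q os θ W g θ≤ xs))
    where
    open ℚ.≤-Reasoning
    step : ∀ k → _ → _
    step k (θ≤ₓ , θ≤ₓₛ) = begin
      θ ℚ.* ι (W x + ∑ xs W)
        ≡⟨ cong (θ ℚ.*_) (ι-+ (W x) (∑ xs W)) ⟩
      θ ℚ.* (ι (W x) ℚ.+ ι (∑ xs W))
        ≡⟨ solve 3 (λ θ a b → θ :* (a :+ b) := a :* θ :+ θ :* b) refl θ (ι (W x)) (ι (∑ xs W)) ⟩
      ι (W x) ℚ.* θ ℚ.+ θ ℚ.* ι (∑ xs W)
        ≤⟨ ℚ.+-mono-≤ (ι*-monoʳ-≤ (W x) θ≤ₓ) θ≤ₓₛ ⟩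
      ι (W x) ℚ.* weighted (q k) os (λ t → g t x) ℚ.+ weighted (q k) os (λ t → ∑ xs (W · g t))
        ≡⟨ cong (ℚ._+ weighted (q k) os (λ t → ∑ xs (W · g t)))
             (weighted-* (q k) os (W x) (λ t → g t x)) ⟨
      weighted (q k) os (λ t → W x * g t x) ℚ.+ weighted (q k) os (λ t → ∑ xs (W · g t))
        ≡⟨ weighted-+ (q k) os (λ t → W x * g t x) (λ t → ∑ xs (W · g t)) ⟨
      weighted (q k) os (λ t → ∑ (x ∷ xs) (W · g t)) ∎
      where open +-*-Solver

  shifted-nonNegative : ∀ {η} → 0ℚ ℚ.< η → ∀ {os : List (ℝ × T)} →
    All (λ (p , _) → 0ᴿ ≤ᴿ p) os → Eventually λ k → All (λ (p , _) → 0ℚ ℚ.≤ shifted η k p) os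
  shifted-nonNegative 0<η [] = 0 , λ _ _ → []
  shifted-nonNegative {η} 0<η (0≤p ∷ 0≤ps) =
    always (λ _ (0≤q , 0≤qs) → 0≤q ∷ 0≤qs) (both (0≤p η 0<η) (shifted-nonNegative 0<η 0≤ps))

  weighted-total : ∀ η k (os : List (ℝ × T)) → weighted (shifted η k) os (λ _ → 1) ≡
    approx (sumᴿ (List.map proj₁ os)) k ℚ.+ ι (length os) ℚ.* η
  weighted-total η k [] = sym (trans (ℚ.+-identityˡ (0ℚ ℚ.* η)) (ℚ.*-zeroˡ η))
  weighted-total η k ((p , t) ∷ os) = trans
    (cong ((approx p k ℚ.+ η) ℚ.* ι 1 ℚ.+_) (weighted-total η k os))
    (solve 4 (λ a h b c → (a :+ h) :* con 1ℚ :+ (b :+ c :* h) := (a :+ b) :+ (con 1ℚ :+ c) :* h)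
      refl (approx p k) η (approx (sumᴿ (List.map proj₁ os)) k) (ι (length os)))
    where open +-*-Solver

  -- Trees kept by the filter have `g` equal to 1 and gain from the shift; the others add
  -- nonnegative terms.
  filtered-≤-weighted : ∀ η → 0ℚ ℚ.≤ η → ∀ k {P : Pred (ℝ × T) 0ℓ} (P? : Decidable P) os g →
    All (λ (p , _) → 0ℚ ℚ.≤ shifted η k p) os → All (λ o → P o → g (proj₂ o) ≡ 1) os →
    approx (sumᴿ (List.map proj₁ (filter P? os))) k ℚ.≤ weighted (shifted η k) os g
  filtered-≤-weighted η 0≤η k P? [] g [] [] = ℚ.≤-refl
  filtered-≤-weighted η 0≤η k P? (o@(p , t) ∷ os) g (0≤q ∷ 0≤qs) (one ∷ ones) with P? o
  ... | yes Po = ℚ.+-mono-≤ single (filtered-≤-weighted η 0≤η k P? os g 0≤qs ones)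
    where
    open ℚ.≤-Reasoning
    single : approx p k ℚ.≤ shifted η k p ℚ.* ι (g t)
    single = begin
      approx p k                   ≡⟨ ℚ.+-identityʳ (approx p k) ⟨
      approx p k ℚ.+ 0ℚ            ≤⟨ ℚ.+-monoʳ-≤ (approx p k) 0≤η ⟩
      shifted η k p                ≡⟨ ℚ.*-identityʳ (shifted η k p) ⟨
      shifted η k p ℚ.* 1ℚ         ≡⟨ cong (λ n → shifted η k p ℚ.* ι n) (one Po) ⟨
      shifted η k p ℚ.* ι (g t)    ∎
  ... | no _ = subst (ℚ._≤ shifted η k p ℚ.* ι (g t) ℚ.+ weighted (shifted η k) os g)
    (ℚ.+-identityˡ _)
    (ℚ.+-mono-≤ nonNeg (filtered-≤-weighted η 0≤η k P? os g 0≤qs ones))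
    where
    nonNeg : 0ℚ ℚ.≤ shifted η k p ℚ.* ι (g t)
    nonNeg = subst (ℚ._≤ shifted η k p ℚ.* ι (g t)) (ℚ.*-zeroʳ (shifted η k p))
      (ℚ.*-monoˡ-≤-nonNeg (shifted η k p) {{ℚ.nonNegative 0≤q}} (0≤ι (g t)))

p≤∣p∣ : ∀ p → p ℚ.≤ ℚ.∣ p ∣
p≤∣p∣ p with ℚ.≤-total 0ℚ p
... | inj₁ 0≤p = ℚ.≤-reflexive (sym (ℚ.0≤p⇒∣p∣≡p 0≤p))
... | inj₂ p≤0 = ℚ.≤-trans p≤0 (ℚ.0≤∣p∣ p)

-- If `δ` separates `ε` from 1, half of it pays for the slack in `1ᴿ -ᴿ ε ≤ᴿ S` and the other half
-- remains as a rational lower bound.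
reliability-margin : ∀ {ε} → ε <ᴿ 1ᴿ → ∃ λ θ → 0ℚ ℚ.< θ ×
  (∀ S → 1ᴿ -ᴿ ε ≤ᴿ S → Eventually λ k → θ ℚ.≤ approx S k)
reliability-margin {ε} (δ , 0<δ , below) = ½ ℚ.* δ , 0<½δ , λ S 1-ε≤S →
  always (λ k (a , b) → margin (approx ε k) (approx S k) a b) (both below (1-ε≤S (½ ℚ.* δ) 0<½δ))
  where
  0<½δ : 0ℚ ℚ.< ½ ℚ.* δ
  0<½δ = subst (ℚ._< ½ ℚ.* δ) (ℚ.*-zeroʳ ½) (ℚ.*-monoʳ-<-pos ½ 0<δ)

  open ℚ.≤-Reasoning
  margin : ∀ e S → e ℚ.+ δ ℚ.≤ 1ℚ → 1ℚ ℚ.+ ℚ.- e ℚ.≤ S ℚ.+ ½ ℚ.* δ → ½ ℚ.* δ ℚ.≤ S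
  margin e S e+δ≤1 1-e≤ = begin
    ½ ℚ.* δ
      ≡⟨ solve 2 (λ e d → con ½ :* d := (e :+ d) :+ (:- e :- con ½ :* d)) refl e δ ⟩
    (e ℚ.+ δ) ℚ.+ (ℚ.- e ℚ.- ½ ℚ.* δ)
      ≤⟨ ℚ.+-monoˡ-≤ (ℚ.- e ℚ.- ½ ℚ.* δ) e+δ≤1 ⟩
    1ℚ ℚ.+ (ℚ.- e ℚ.- ½ ℚ.* δ)
      ≡⟨ ℚ.+-assoc 1ℚ (ℚ.- e) (ℚ.- (½ ℚ.* δ)) ⟨
    1ℚ ℚ.+ ℚ.- e ℚ.- ½ ℚ.* δ
      ≤⟨ ℚ.+-monoˡ-≤ (ℚ.- (½ ℚ.* δ)) 1-e≤ ⟩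
    S ℚ.+ ½ ℚ.* δ ℚ.- ½ ℚ.* δ
      ≡⟨ solve 2 (λ s h → s :+ h :- h := s) refl S (½ ℚ.* δ) ⟩
    S ∎
    where open +-*-Solver

-- On average over `W`, the algorithm succeeds with probability at least `θ`, yet each tree with at
-- most `c / n`. The approximate weights total at most 3, so `θ ≤ 3 c / n`, and `D` is a bound for
-- `1 / θ`. As `θ` comes from `ε` alone, `D` is fixed before `f`.
reliable⇒short : ∀ {ε} → ε <ᴿ 1ᴿ → ∃ λ D →
  ∀ {m} {Z : Set} (f : Bits m → Z) (_≟_ : DecidableEquality Z) {n q c} →
  Unreliable f _≟_ n q c →
  (A : RandomizedAlgorithm (Fin n × Fin m) (Vec Z n)) →
  (∀ v → 1ᴿ -ᴿ ε ≤ᴿ successProbability (bitAt) (f ^⊗ n) (Vec.≡-dec _≟_) A v) →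
  All (λ (_ , t) → ∀ v → queries t (bitAt v) ≤ q) (outcomes A) →
  n ≤ c * 3 * D
reliable⇒short {ε} ε<1 = D , short
  where
  θ : ℚ
  θ = proj₁ (reliability-margin {ε} ε<1)

  0<θ : 0ℚ ℚ.< θ
  0<θ = proj₁ (proj₂ (reliability-margin {ε} ε<1))

  D : ℕ
  D = proj₁ (archimedean θ 0<θ)

  short : ∀ {m} {Z : Set} (f : Bits m → Z) (_≟_ : DecidableEquality Z) {n q c} →
    Unreliable f _≟_ n q c →
    (A : RandomizedAlgorithm (Fin n × Fin m) (Vec Z n)) →
    (∀ v → 1ᴿ -ᴿ ε ≤ᴿ successProbability (bitAt) (f ^⊗ n) (Vec.≡-dec _≟_) A v) →
    All (λ (_ , t) → ∀ v → queries t (bitAt v) ≤ q) (outcomes A) →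
    n ≤ c * 3 * D
  short {m} {Z} f _≟_ {n} {q} {c} (W , 0<M , few) A reliable fast =
    let K , holds = both (both positive-weights bounded-total)
          (average (shifted η) os θ W (good f _≟_ q) reliable-at (inputs n m))
        (nonNeg , total≤3) , averaged = holds K ℕ.≤-refl
    in conclude (shifted η K) nonNeg total≤3 averaged
    where
    os : List (ℝ × Tree m n Z)
    os = outcomes A

    M : ℕ
    M = ∑ (inputs n m) W

    instance
      L≢0 : ℚ.NonZero (ι (suc (length os)))
      L≢0 = ℚ.pos⇒nonZero (ι (suc (length os))) {{ι-positive (length os)}}

    -- Small enough for the shifts of all the weights together to add at most 1.
    η : ℚ
    η = ℚ.1/ ι (suc (length os))

    0<η : 0ℚ ℚ.< η
    0<η = ℚ.positive⁻¹ η {{ℚ.1/pos⇒pos (ι (suc (length os))) {{ι-positive (length os)}}}}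

    positive-weights : Eventually λ k → All (λ (p , _) → 0ℚ ℚ.≤ shifted η k p) os
    positive-weights = shifted-nonNegative 0<η (nonNegative A)

    Lη≤1 : ι (length os) ℚ.* η ℚ.≤ 1ℚ
    Lη≤1 = ℚ.≤-trans
      (ℚ.*-monoʳ-≤-nonNeg η {{ℚ.nonNegative (ℚ.<⇒≤ 0<η)}} (ι-mono (ℕ.n≤1+n (length os))))
      (ℚ.≤-reflexive (ℚ.*-inverseʳ (ι (suc (length os)))))

    -- The 3 is made of the exact total 1, an approximation error below 1, and the shifts.
    bounded-total : Eventually λ k → weighted (shifted η k) os (λ _ → 1) ℚ.≤ ι 3
    bounded-total = always bound (total A 1ℚ (ℚ.positive⁻¹ 1ℚ))
      where
      open ℚ.≤-Reasoning
      bound : ∀ k → ℚ.∣ approx (sumᴿ (List.map proj₁ os)) k ℚ.- 1ℚ ∣ ℚ.< 1ℚ →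
        weighted (shifted η k) os (λ _ → 1) ℚ.≤ ι 3
      bound k close = begin
        weighted (shifted η k) os (λ _ → 1)
          ≡⟨ weighted-total η k os ⟩
        S ℚ.+ ι (length os) ℚ.* η
          ≡⟨ cong (ℚ._+ ι (length os) ℚ.* η) (solve 1 (λ s → s := (s :- con 1ℚ) :+ con 1ℚ) refl S) ⟩
        S ℚ.- 1ℚ ℚ.+ 1ℚ ℚ.+ ι (length os) ℚ.* η
          ≤⟨ ℚ.+-mono-≤ (ℚ.+-monoˡ-≤ 1ℚ
               (ℚ.≤-trans (p≤∣p∣ (S ℚ.- 1ℚ)) (ℚ.<⇒≤ close))) Lη≤1 ⟩
        1ℚ ℚ.+ 1ℚ ℚ.+ 1ℚ ∎
        where
        open +-*-Solver
        S : ℚ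
        S = approx (sumᴿ (List.map proj₁ os)) k

    accuracy : Vec (Bits m) n → ℝ
    accuracy = successProbability bitAt (f ^⊗ n) (Vec.≡-dec _≟_) A

    reliable-at : ∀ v → Eventually λ k →
      θ ℚ.≤ weighted (shifted η k) os (λ t → good f _≟_ q t v)
    reliable-at v = always
      (λ k (nonNeg , θ≤) → ℚ.≤-trans θ≤ (filtered-≤-weighted η (ℚ.<⇒≤ 0<η) k _ os _ nonNeg
        (All.map (λ {(_ , t)} fast correct → correct⇒good f _≟_ q t v correct (fast v)) fast)))
      (both positive-weights
        (proj₂ (proj₂ (reliability-margin {ε} ε<1)) (accuracy v) (reliable v)))

    F : Tree m n Z → ℕ
    F t = ∑ (inputs n m) (W · good f _≟_ q t)

    conclude : ∀ w → All (λ (p , _) → 0ℚ ℚ.≤ w p) os → weighted w os (λ _ → 1) ℚ.≤ ι 3 →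
      θ ℚ.* ι M ℚ.≤ weighted w os F → n ≤ c * 3 * D
    conclude w nonNeg total≤3 averaged =
      ℕ.*-cancelʳ-≤ n (c * 3 * D) M {{>-nonZero 0<M}} (ι-cancel-≤ (begin
        ι (n * M)
          ≡⟨ ℚ.*-identityˡ (ι (n * M)) ⟨
        1ℚ ℚ.* ι (n * M)
          ≤⟨ ι*-monoˡ-≤ (n * M) (proj₂ (archimedean θ 0<θ)) ⟩
        ι D ℚ.* θ ℚ.* ι (n * M)
          ≡⟨ cong (ι D ℚ.* θ ℚ.*_) (ι-* n M) ⟩
        ι D ℚ.* θ ℚ.* (ι n ℚ.* ι M)
          ≡⟨ solve 4 (λ d θ n m → d :* θ :* (n :* m) := d :* (n :* (θ :* m))) refl
               (ι D) θ (ι n) (ι M) ⟩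
        ι D ℚ.* (ι n ℚ.* (θ ℚ.* ι M))
          ≤⟨ ι*-monoʳ-≤ D (ι*-monoʳ-≤ n averaged) ⟩
        ι D ℚ.* (ι n ℚ.* weighted w os F)
          ≡⟨ cong (ι D ℚ.*_) (weighted-* w os n F) ⟨
        ι D ℚ.* weighted w os (λ t → n * F t)
          ≤⟨ ι*-monoʳ-≤ D (weighted-mono w os nonNeg λ t →
               subst₂ _≤_ (ℕ.*-comm (F t) n) (sym (ℕ.*-identityʳ (c * M))) (few t)) ⟩
        ι D ℚ.* weighted w os (λ t → c * M * 1)
          ≡⟨ cong (ι D ℚ.*_) (weighted-* w os (c * M) (λ _ → 1)) ⟩
        ι D ℚ.* (ι (c * M) ℚ.* weighted w os (λ t → 1))
          ≤⟨ ι*-monoʳ-≤ D (ι*-monoʳ-≤ (c * M) total≤3) ⟩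
        ι D ℚ.* (ι (c * M) ℚ.* ι 3)
          ≡⟨ cong (ι D ℚ.*_) (ι-* (c * M) 3) ⟨
        ι D ℚ.* ι (c * M * 3)
          ≡⟨ ι-* D (c * M * 3) ⟨
        ι (D * (c * M * 3))
          ≡⟨ cong ι (rearrange D c M) ⟩
        ι (c * 3 * D * M) ∎))
      where
      open ℚ.≤-Reasoning
      open +-*-Solver
      rearrange : ∀ D c M → D * (c * M * 3) ≡ c * 3 * D * M
      rearrange = solve-∀

-- Comparison with the square root and the lower bound

square-cancel-≤ : ∀ {a b} → a * a ≤ b * b → a ≤ b
square-cancel-≤ {a} {b} a²≤b² =
  ℕ.≮⇒≥ λ b<a → ℕ.<⇒≱ (ℕ.*-mono-< b<a b<a) a²≤b²

-- Since `d ≤ s (s + 1) ≤ (2 s)²`, every approximation of the root is at most `2 s`, and an eighth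
-- of that is `s / 4 ≤ r / (n + 1)`.
⅛√≤ : ∀ d s r n k → d ≤ s * suc s → s * suc n ≤ 4 * r →
  (+ 1 / 8) ℚ.* √-approx d k ℚ.≤ + r / suc n
⅛√≤ d s r n k d≤ s≤ = ℚ.toℚᵘ-cancel-≤
  (ℚᵘ.≤-respˡ-≃ (ℚᵘ.≃-sym (ℚᵘ.≃-trans (ℚ.toℚᵘ-homo-* (+ 1 / 8) (√-approx d k))
      (ℚᵘ.*-cong (ℚ.toℚᵘ-fromℚᵘ (ℚᵘ.mkℚᵘ (+ 1) 7)) (ℚ.toℚᵘ-fromℚᵘ (ℚᵘ.mkℚᵘ (+ t) k)))))
    (ℚᵘ.≤-respʳ-≃ (ℚᵘ.≃-sym (ℚ.toℚᵘ-fromℚᵘ (ℚᵘ.mkℚᵘ (+ r) n)))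
      (ℚᵘ.*≤* (subst₂ ℤ._≤_ left (ℤ.pos-* r (8 * suc k)) (ℤ.+≤+ cross)))))
  where
  open ℕ.≤-Reasoning
  t : ℕ
  t = ⌊√ d * (suc k * suc k) ⌋

  left : + (t * suc n) ≡ + 1 ℤ.* + t ℤ.* + suc n
  left = trans (ℤ.pos-* t (suc n)) (cong (ℤ._* + suc n) (sym (ℤ.*-identityˡ (+ t))))

  s[1+s]≤4s² : ∀ s → s * suc s ≤ (s + s) * (s + s)
  s[1+s]≤4s² zero = z≤n
  s[1+s]≤4s² (suc s) = ℕ.*-mono-≤ (ℕ.m≤m+n (suc s) (suc s)) (s≤s (ℕ.m≤n+m (suc s) s))

  t≤ : t ≤ (s + s) * suc k
  t≤ = square-cancel-≤ (begin
    t * t                                      ≤⟨ ⌊√⌋-lower (d * (suc k * suc k)) ⟩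
    d * (suc k * suc k)                        ≤⟨ ℕ.*-monoˡ-≤ (suc k * suc k)
                                                    (ℕ.≤-trans d≤ (s[1+s]≤4s² s)) ⟩
    (s + s) * (s + s) * (suc k * suc k)    ≡⟨ ℕ.[m*n]*[o*p]≡[m*o]*[n*p]
                                                    (s + s) (s + s) (suc k) (suc k) ⟩
    (s + s) * suc k * ((s + s) * suc k)    ∎)

  cross : t * suc n ≤ r * (8 * suc k)
  cross = begin
    t * suc n                      ≤⟨ ℕ.*-monoˡ-≤ (suc n) t≤ ⟩
    (s + s) * suc k * suc n      ≡⟨ expand s (suc k) (suc n) ⟩
    s * suc n * (2 * suc k)        ≤⟨ ℕ.*-monoˡ-≤ (2 * suc k) s≤ ⟩
    4 * r * (2 * suc k)            ≡⟨ collect r (suc k) ⟩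
    r * (8 * suc k)                ∎
    where
    expand : ∀ s k n → (s + s) * k * n ≡ s * n * (2 * k)
    expand = solve-∀
    collect : ∀ r k → 4 * r * (2 * k) ≡ r * (8 * k)
    collect = solve-∀

corollary2 : ∀ (ε : ℝ) → 0ᴿ ≤ᴿ ε → ε <ᴿ 1ᴿ →
    ∃ λ (C : ℝ) → 0ᴿ <ᴿ C ×
    (∀ {m} → 1 ≤ m →
    ∀ {Z : Set} {k} (Z-finite : Z ↔ Fin k) (f : Bits m → Z) →
    ∀ (d : ℕ) → D≡ f d →
    ∀ (R : ℕ → ℕ) → (∀ n → R^⊗≡ f Z-finite ε n (R n)) →
    liminf (λ n → fromℚ (+ R (suc n) / suc n)) ≥ (C *ᴿ √ d))
-- The factor 4 in `4 * q ≤ s * n` and the factor 2 in `√d ≤ 2 s` give 1/8. It serves every `ε`,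
-- which affects only how large `n` has to be.
corollary2 ε _ ε<1 = fromℚ (+ 1 / 8)
  , (+ 1 / 8 , ℚ.positive⁻¹ (+ 1 / 8) , 0 , λ _ _ → ℚ.≤-reflexive (ℚ.+-identityˡ (+ 1 / 8)))
  , λ _ → lower-bound
  where
  lower-bound : ∀ {m} {Z : Set} {k} (Z-finite : Z ↔ Fin k) (f : Bits m → Z) →
    ∀ (d : ℕ) → D≡ f d →
    ∀ (R : ℕ → ℕ) → (∀ n → R^⊗≡ f Z-finite ε n (R n)) →
    liminf (λ n → fromℚ (+ R (suc n) / suc n)) ≥ (fromℚ (+ 1 / 8) *ᴿ √ d)
  lower-bound {m} Z-finite f d D≡d R R≡ y (δ , 0<δ , y+δ≤) =
    always (λ n many δ′ 0<δ′ → always (λ k y+δ≤ → bound n many k δ′ 0<δ′ y+δ≤) y+δ≤) queries-many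
    where
    _≟_ : DecidableEquality _
    _≟_ = inj⇒≟ (↔⇒↣ Z-finite)

    open ℚ.≤-Reasoning

    s : ℕ
    s = proj₁ (certificate-complexity f _≟_)

    d≤ : d ≤ s * suc s
    d≤ = deterministic-upper-bound f _≟_ D≡d (proj₁ (proj₂ (certificate-complexity f _≟_)))

    queries-many : Eventually λ n → s * suc n ≤ 4 * R (suc n)
    queries-many with certificate-complexity f _≟_
    -- Here `f` is constant and the bound is trivial.
    ... | zero , _ , _ = 0 , λ _ _ → z≤n
    ... | suc _ , _ , inj₁ ()
    ... | suc r , _ , inj₂ (x , hard) =
      let D , short = reliable⇒short {ε} ε<1
          c , unreliable = hard⇒unreliable f _≟_ x (suc r) (s≤s z≤n) hard
      -- With too few queries `reliable⇒short` would give `n + 1 ≤ 3 c D`, while `n` is at least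
      -- `3 c D`.
      in c * 3 * D , λ n n≥ → ℕ.≮⇒≥ λ few →
        let (A , reliable , fast) , _ = R≡ (suc n)
        in ℕ.<⇒≱ (short f _≟_ {c = c} (unreliable (suc n) (R (suc n)) (ℕ.<⇒≤ few)) A reliable fast) n≥

    bound : ∀ n → s * suc n ≤ 4 * R (suc n) → ∀ k δ′ → 0ℚ ℚ.< δ′ →
      approx y k ℚ.+ δ ℚ.≤ (+ 1 / 8) ℚ.* √-approx d k →
      approx y k ℚ.≤ + R (suc n) / suc n ℚ.+ δ′
    bound n many k δ′ 0<δ′ y+δ≤ = begin
      approx y k                       ≡⟨ ℚ.+-identityʳ (approx y k) ⟨
      approx y k ℚ.+ 0ℚ                ≤⟨ ℚ.+-monoʳ-≤ (approx y k) (ℚ.<⇒≤ 0<δ) ⟩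
      approx y k ℚ.+ δ                 ≤⟨ y+δ≤ ⟩
      (+ 1 / 8) ℚ.* √-approx d k       ≤⟨ ⅛√≤ d s (R (suc n)) n k d≤ many ⟩
      + R (suc n) / suc n              ≡⟨ ℚ.+-identityʳ (+ R (suc n) / suc n) ⟨
      + R (suc n) / suc n ℚ.+ 0ℚ       ≤⟨ ℚ.+-monoʳ-≤ (+ R (suc n) / suc n) (ℚ.<⇒≤ 0<δ′) ⟩
      + R (suc n) / suc n ℚ.+ δ′       ∎
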